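{- Let $q$ be a prime power, let $n,k,d$ be positive integers with $k>d\geq 2$ and $n\geq 2k+1$, and let $V$ be an $n$-dimensional vector space over $\mathbb{F}_q$. Suppose $\mathcal{F}\subseteq \left[V\atop k\right]_q$ is an intersecting family, i.e. $\dim(F\cap F')\geq 1$ for all $F,F'\in\mathcal{F}$. Then $$\delta_d(\mathcal{F})\leq \left[n-d-1\atop k-d-1\right]_q.$$
   Context: $\left[V\atop k\right]_q$ denotes the set of all $k$-dimensional subspaces of $V$. For $m\in\mathbb{R}$ and a positive integer $k$, the Gaussian binomial coefficient is $\left[m\atop k\right]_q=\prod_{i=0}^{k-1}\frac{q^{m-i}-1}{q^{k-i}-1}$; $\left[m\atop 0\right]_q=1$ and $\left[m\atop k\right]_q=0$ for negative integers $k$. For a family $\mathcal{F}\subseteq\left[V\atop k\right]_q$ and a subspace $S\leq V$, the $S$-degree is $d_S(\mathcal{F})=|\{F\in\mathcal{F}: S\leq F\}|$, and for $1\le d\le k$ the minimum $d$-degree is $\delta_d(\mathcal{F})=\min\{d_S(\mathcal{F}): S\leq V,\ \dim S=d\}$. -}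

module Defs where

open import Data.Nat as ℕ using (ℕ; zero; suc; _∸_; _^_; _/_)
open import Data.Fin using (Fin)
open import Data.Vec using (Vec; []; _∷_; replicate; zipWith; map)
open import Data.Bool using (Bool; true; false; _∧_)
open import Data.List using (List; length; filter)
open import Data.Product using (Σ; ∃; _×_; _,_)
open import Data.Empty using (⊥)
open import Function.Bundles using (_⇔_)
open import Relation.Nullary using (¬_; Dec; yes; no)
open import Relation.Binary.PropositionalEquality using (_≡_; _≢_; refl)
open import Algebra.Structures using (IsCommutativeRing)
import Data.Fin.Properties as FinP

-- Gaussian binomial coefficient, by the product formula
--   [m k]_q = ∏_{i=0}^{k-1} (q^{m-i} - 1) / (q^{k-i} - 1)
-- computed as (product of numerators) / (product of denominators).
-- (Division by 0, which never occurs for q ≥ 2, returns 0.)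

prodUpTo : ℕ → (ℕ → ℕ) → ℕ
prodUpTo zero    f = 1
prodUpTo (suc k) f = prodUpTo k f ℕ.* f k

safeDiv : ℕ → ℕ → ℕ
safeDiv a zero    = 0
safeDiv a (suc b) = a / suc b

gaussBinom : (q m k : ℕ) → ℕ
gaussBinom q m k =
  safeDiv (prodUpTo k (λ i → q ^ (m ∸ i) ∸ 1))
          (prodUpTo k (λ i → q ^ (k ∸ i) ∸ 1))

-- A finite field with q elements, with carrier Fin q and propositional
-- equality. (Every finite field is isomorphic to one of this form; its
-- order q is automatically a prime power, and every prime power q
-- admits one.)

record FiniteField (q : ℕ) : Set where
  field
    _+_ _*_ : Fin q → Fin q → Fin q
    -_      : Fin q → Fin q
    0# 1#   : Fin q
    isCommutativeRing : IsCommutativeRing _≡_ _+_ _*_ -_ 0# 1#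
    0≢1     : 0# ≢ 1#
    inverse : ∀ x → x ≢ 0# → ∃ λ y → x * y ≡ 1#

allVec? : {q : ℕ} (m : ℕ) {P : Vec (Fin q) m → Set} →
          (∀ v → Dec (P v)) → Dec (∀ v → P v)
allVec? zero P? with P? []
... | yes p = yes λ { [] → p }
... | no ¬p = no λ f → ¬p (f [])
allVec? (suc m) P? with FinP.all? (λ x → allVec? m (λ w → P? (x ∷ w)))
... | yes h = yes λ { (x ∷ w) → h x w }
... | no ¬h = no λ f → ¬h (λ x w → f (x ∷ w))

module Space {q : ℕ} (𝔽 : FiniteField q) (n : ℕ) where
  open FiniteField 𝔽

  V : Set
  V = Vec (Fin q) n

  zeroV : V
  zeroV = replicate n 0#

  _+V_ : V → V → V
  _+V_ = zipWith _+_

  _·V_ : Fin q → V → V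
  c ·V v = map (c *_) v

  lincomb : (m : ℕ) → (Fin m → Fin q) → (Fin m → V) → V
  lincomb zero    c b = zeroV
  lincomb (suc m) c b =
    (c Fin.zero ·V b Fin.zero) +V lincomb m (λ i → c (Fin.suc i)) (λ i → b (Fin.suc i))

  LinIndep : (m : ℕ) → (Fin m → V) → Set
  LinIndep m b = ∀ (c : Fin m → Fin q) → lincomb m c b ≡ zeroV → ∀ i → c i ≡ 0#

  Subset : Set
  Subset = V → Bool

  _∈V_ : V → Subset → Set
  v ∈V S = S v ≡ true

  _∩_ : Subset → Subset → Subset
  (S ∩ T) v = S v ∧ T v

  IsSubspaceOfDim : ℕ → Subset → Set
  IsSubspaceOfDim m S =
    Σ (Fin m → V) λ b → LinIndep m b ×
      (∀ v → (v ∈V S) ⇔ (∃ λ c → lincomb m c b ≡ v))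

  DimAtLeast : ℕ → Subset → Set
  DimAtLeast r S = ∃ λ m → r ℕ.≤ m × IsSubspaceOfDim m S

  SameSet : Subset → Subset → Set
  SameSet S T = ∀ v → S v ≡ T v

  _⊆_ : Subset → Subset → Set
  S ⊆ T = ∀ v → v ∈V S → v ∈V T

  _⊆?_ : (S T : Subset) → Dec (S ⊆ T)
  S ⊆? T = allVec? n (λ v → implies (S v) (T v))
    where
      implies : (a b : Bool) → Dec (a ≡ true → b ≡ true)
      implies false b     = yes (λ ())
      implies true  true  = yes (λ _ → refl)
      implies true  false = no (λ f → lem (f refl))
        where lem : false ≡ true → ⊥
              lem ()

  degree : Subset → List Subset → ℕ
  degree S ℱ = length (filter (λ F → S ⊆? F) ℱ)

{-# OPTIONS --safe #-}
-- Call a subspace a cover if it meets every member of ℱ, and let T be a cover of least dimension τ.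
-- Suppose every d-space lies in more than [n−d−1, k−d−1] members.  Averaging over the d-spaces that
-- meet T trivially gives a lower bound on |ℱ| that is, up to a factor 1 − O(q^(d+τ−n)), the size
-- [n−1, k−1] of a star; for τ = 1 it already exceeds it.  For an upper bound, a member through a
-- non-cover U contains U + ⟨a⟩ for some nonzero a in any cover that meets U trivially, in particular in
-- any member of ℱ missing U.  Iterating from T up to dimension τ loses a factor up to q, which is
-- regained as follows.  If τ = k, the last two factors of the count suffice.  If some point p of T lies
-- in every cover of dimension < k, then the members avoiding p admit k such steps, and these members
-- and those through p each number at most a 1/q fraction of the bound.  Otherwise every p in T is
-- missed by a cover of dimension < k, and branching over that cover at the second step gains a factor q.
module Submission where

open import Defs
open import Data.Nat
open import Data.Nat.Properties
open import Data.Nat.DivMod using (m≡m%n+[m/n]*n; m%n<n)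
open import Data.Nat.Tactic.RingSolver using (solve-∀)
open import Data.Bool using (Bool; true; false; _∧_; not)
import Data.Bool.Properties as Bool
open import Data.Bool.ListAction using (all)
open import Data.Fin using (Fin)
import Data.Fin.Properties as Fin
open import Data.Fin.Permutation using (Permutation; permutation; _⟨$⟩ʳ_)
open import Data.List using (List; []; _∷_; _++_; length; map; allFin; lookup; cartesianProductWith)
import Data.List as List
open import Data.List.Properties using (tabulate-lookup; length-tabulate; length-++)
open import Data.List.Membership.Propositional using (_∈_; lose)
open import Data.List.Membership.Propositional.Properties using (∈-allFin; ∈-cartesianProductWith⁺)
open import Data.List.Relation.Unary.All as All using (All)
open import Data.List.Relation.Unary.AllPairs using (AllPairs; []; _∷_)
open import Data.List.Relation.Unary.Any as Any using (Any; here; there)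
import Data.List.Relation.Unary.Unique.Propositional.Properties as Unique
open import Data.Vec as Vec using (Vec; []; _∷_; zipWith)
import Data.Vec.Properties as VecP
open import Data.Product using (∃; _×_; _,_; proj₁; proj₂)
open import Data.Sum using (inj₁; inj₂)
open import Data.Empty using (⊥; ⊥-elim)
open import Data.Unit using (⊤; tt)
open import Function using (_∘_; id)
open import Function.Bundles using (_⇔_; mk⇔; Equivalence)
open import Relation.Nullary using (¬_; Dec; yes; no; does; contradiction)
open import Relation.Nullary.Decidable using (dec-true; decidable-stable; _×-dec_)
open import Relation.Binary.PropositionalEquality
open import Algebra.Structures using (IsCommutativeRing)
open import Algebra.Properties.CommutativeSemigroup +-commutativeSemigroup using (x∙yz≈y∙xz) renaming (interchange to +-interchange)
import Algebra.Properties.CommutativeMonoid.Sum +-0-commutativeMonoid as Sum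

-- Auxiliary arithmetic.

*-interchange : ∀ a b c d → (a * b) * (c * d) ≡ (a * c) * (b * d)
*-interchange = solve-∀

^-distrib-* : ∀ a b s → (a * b) ^ s ≡ a ^ s * b ^ s
^-distrib-* a b zero    = refl
^-distrib-* a b (suc s) = trans (cong (a * b *_) (^-distrib-* a b s)) (*-interchange a b (a ^ s) (b ^ s))

-- Rounding down is harmless in this direction: if `a / b` is below the integer `x`, then
-- `suc (a / b) ≤ x`, and `a` is less than `suc (a / b) * b`.
<-safeDiv⇒< : ∀ a b x → 0 < b → safeDiv a b < x → a < x * b
<-safeDiv⇒< a b@(suc b′) x _ a/b<x = begin-strict
  a                        ≡⟨ m≡m%n+[m/n]*n a b ⟩
  a % b + (a / b) * b      <⟨ +-monoˡ-< ((a / b) * b) (m%n<n a b) ⟩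
  suc (a / b) * b          ≤⟨ *-monoˡ-≤ b a/b<x ⟩
  x * b                    ∎
  where open ≤-Reasoning

m+1+n≡o⇒m<o : ∀ {m n o} → m + suc n ≡ o → m < o
m+1+n≡o⇒m<o {m} {n} refl = m<m+n m (s≤s z≤n)

-- Products of consecutive factors q^m - q^i.

module Falling (q : ℕ) (2≤q : 2 ≤ q) where

  instance
    q≢0 : NonZero q
    q≢0 = >-nonZero (≤-trans (s≤s z≤n) 2≤q)

    q∸1≢0 : NonZero (q ∸ 1)
    q∸1≢0 = >-nonZero (∸-monoˡ-≤ 1 2≤q)

  1≤q^ : ∀ m → 1 ≤ q ^ m
  1≤q^ = m^n>0 q

  -- ∏_{a ≤ i < a + l} (q^m − q^i)
  fall : ℕ → ℕ → ℕ → ℕ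
  fall m a zero    = 1
  fall m a (suc l) = (q ^ m ∸ q ^ a) * fall m (suc a) l

  fall-+ : ∀ m a l l′ → fall m a (l + l′) ≡ fall m a l * fall m (a + l) l′
  fall-+ m a zero    l′ rewrite +-identityʳ a = sym (*-identityˡ _)
  fall-+ m a (suc l) l′ rewrite fall-+ m (suc a) l l′ | +-suc a l =
    sym (*-assoc (q ^ m ∸ q ^ a) _ _)

  fall-anti : ∀ m {a b} l → a ≤ b → fall m b l ≤ fall m a l
  fall-anti m zero    a≤b = ≤-refl
  fall-anti m (suc l) a≤b =
    *-mono-≤ (∸-monoʳ-≤ (q ^ m) (^-monoʳ-≤ q a≤b)) (fall-anti m l (s≤s a≤b))

  -- On both sides the two index ranges start at `d + 1` and `s + 1`. They end at `d + e` and
  -- `s + d` on the left, at `d + s` and `s + l` on the right, and `d + e ≡ s + l`; so only the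
  -- segment between the two ends changes sides.
  fall-exchange : ∀ m {d e s l} → d + e ≡ s + l →
    fall m (suc d) e * fall m (suc s) d ≡ fall m (suc d) s * fall m (suc s) l
  fall-exchange m {d} {e} {s} {l} eq with ≤-total d l
  ... | inj₁ d≤l with x , refl ← m≤n⇒∃[o]m+o≡n d≤l
                 with refl ← +-cancelˡ-≡ d e (s + x) (trans eq (x∙yz≈y∙xz s d x))
    rewrite fall-+ m (suc d) s x | fall-+ m (suc s) d x | +-comm d s =
    rearrange (fall m (suc (s + d)) x) (fall m (suc d) s) (fall m (suc s) d)
    where
    rearrange : ∀ b a c → a * b * c ≡ a * (c * b)
    rearrange = solve-∀
  ... | inj₂ l≤d with x , refl ← m≤n⇒∃[o]m+o≡n l≤d
                 with refl ← +-cancelˡ-≡ l (x + e) s (trans (sym (+-assoc l x e)) (trans eq (+-comm s l)))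
    rewrite +-comm x e | fall-+ m (suc (l + x)) e x | fall-+ m (suc (e + x)) l x
          | trans (+-assoc l x e) (trans (cong (l +_) (+-comm x e)) (+-comm l (e + x))) =
    rearrange (fall m (suc (l + x)) e) (fall m (suc (e + x)) l) (fall m (suc (e + x + l)) x)
    where
    rearrange : ∀ a b c → a * (b * c) ≡ a * c * b
    rearrange = solve-∀

  gap : ∀ a b → q ^ (a + b) ∸ q ^ a ≡ q ^ a * (q ^ b ∸ 1)
  gap a b = begin-equality
    q ^ (a + b) ∸ q ^ a           ≡⟨ cong₂ _∸_ (^-distribˡ-+-* q a b) (sym (*-identityʳ (q ^ a))) ⟩
    q ^ a * q ^ b ∸ q ^ a * 1     ≡⟨ *-distribˡ-∸ (q ^ a) (q ^ b) 1 ⟨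
    q ^ a * (q ^ b ∸ 1)           ∎
    where open ≤-Reasoning

  -- The room for the spare `q` comes from `2 * k + 1 ≤ n`: `q * Q * Q` is at most `q ^ n`, and its
  -- part `q * Q * A` absorbs `q ^ (d + a)`. The factor `q ^ k ∸ 1` stands for one branching over
  -- the nonzero vectors of a member.
  factor-bound : ∀ {n k d} a → d < k → 2 * k + 1 ≤ n → a ≤ k →
    q * (q ^ k ∸ 1) * (q ^ k ∸ q ^ a) ≤ q ^ n ∸ q ^ (d + a)
  factor-bound {n} {k} {d} a d<k 2k+1≤n a≤k = m+n≤o⇒m≤o∸n _ (begin
    q * (Q ∸ 1) * (Q ∸ A) + q ^ (d + a)  ≤⟨ +-mono-≤ (*-monoˡ-≤ (Q ∸ A) (*-monoʳ-≤ q (m∸n≤m Q 1))) D≤ ⟩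
    q * Q * (Q ∸ A) + q * Q * A          ≡⟨ *-distribˡ-+ (q * Q) (Q ∸ A) A ⟨
    q * Q * (Q ∸ A + A)                  ≡⟨ cong (q * Q *_) (m∸n+n≡m (^-monoʳ-≤ q a≤k)) ⟩
    q * Q * Q                            ≡⟨ *-assoc q Q Q ⟩
    q * (Q * Q)                          ≡⟨ cong (q *_) (^-distribˡ-+-* q k k) ⟨
    q ^ suc (k + k)                      ≤⟨ ^-monoʳ-≤ q (≤-trans (≤-reflexive (double k)) 2k+1≤n) ⟩
    q ^ n                                ∎)
    where
    open ≤-Reasoning
    Q = q ^ k
    A = q ^ a
    double : ∀ k → suc (k + k) ≡ 2 * k + 1
    double = solve-∀
    D≤ : q ^ (d + a) ≤ q * Q * A
    D≤ = begin
      q ^ (d + a)      ≡⟨ ^-distribˡ-+-* q d a ⟩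
      q ^ d * A        ≤⟨ *-monoˡ-≤ A (^-monoʳ-≤ q (<⇒≤ d<k)) ⟩
      Q * A            ≤⟨ *-monoˡ-≤ A (m≤n*m Q q) ⟩
      q * Q * A        ∎

  fall-bound : ∀ {n k d} a s → d < k → 2 * k + 1 ≤ n → a + s ≤ suc k →
    (q * (q ^ k ∸ 1)) ^ s * fall k a s ≤ fall n (d + a) s
  fall-bound a zero _ _ _ = ≤-refl
  fall-bound {n} {k} {d} a (suc s) d<k 2k+1≤n a+s≤ rewrite +-suc a s = begin
    x * x ^ s * ((q ^ k ∸ q ^ a) * fall k (suc a) s)    ≡⟨ *-interchange x (x ^ s) _ _ ⟩
    x * (q ^ k ∸ q ^ a) * (x ^ s * fall k (suc a) s)    ≤⟨ *-mono-≤ (factor-bound a d<k 2k+1≤n (≤-trans (m≤m+n a s) (s≤s⁻¹ a+s≤)))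
                                                            (fall-bound (suc a) s d<k 2k+1≤n a+s≤) ⟩
    (q ^ n ∸ q ^ (d + a)) * fall n (d + suc a) s        ≡⟨ cong (λ z → (q ^ n ∸ q ^ (d + a)) * fall n z s) (+-suc d a) ⟩
    (q ^ n ∸ q ^ (d + a)) * fall n (suc (d + a)) s      ∎
    where
    open ≤-Reasoning
    x = q * (q ^ k ∸ 1)

  -- Applied to all k − 1 factors, fall-bound misses this by a factor (q^k − 1) / (q^(k−1) (q − 1)^k);
  -- the last two factors, where q^k − q^i is well below q^k, make up for it.
  fall-bound-full : ∀ {n k d} → 2 < k → d < k → 2 * k + 1 ≤ n →
    (q ^ k ∸ 1) ^ k * fall k 1 (k ∸ 1) ≤ (q ∸ 1) ^ k * fall n (suc d) (k ∸ 1)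
  fall-bound-full {n} {k@(suc (suc (suc m)))} {d} (s≤s (s≤s (s≤s _))) d<k 2k+1≤n = begin
    y ^ (3 + m) * fall k 1 (2 + m)                              ≡⟨ cong₂ _*_ (^-distribˡ-+-* y 3 m) (trans (cong (fall k 1) (+-comm 2 m)) (fall-+ k 1 m 2)) ⟩
    y ^ 3 * y ^ m * (fall k 1 m * fall k (1 + m) 2)             ≡⟨ shuffle₁ (y ^ 3) (y ^ m) (fall k 1 m) _ ⟩
    -- `fall-bound` on the first `m = k − 3` factors will supply a spare `q ^ m`, named `g`. The
    -- last two factors may therefore absorb `y ^ 3` at a cost of `(q ∸ 1) * g`.
    (y ^ m * fall k 1 m) * (y ^ 3 * fall k (1 + m) 2)           ≤⟨ *-monoʳ-≤ (y ^ m * fall k 1 m) last-two ⟩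
    (y ^ m * fall k 1 m) * ((q ∸ 1) * g * fall n (d + 1 + m) 2) ≡⟨ shuffle₂ (y ^ m) (fall k 1 m) (q ∸ 1) g _ ⟩
    (q ∸ 1) * ((g * y ^ m) * fall k 1 m * fall n (d + 1 + m) 2) ≡⟨ cong (λ z → (q ∸ 1) * (z * fall k 1 m * fall n (d + 1 + m) 2)) (^-distrib-* q y m) ⟨
    (q ∸ 1) * ((q * y) ^ m * fall k 1 m * fall n (d + 1 + m) 2) ≤⟨ *-monoʳ-≤ (q ∸ 1) (*-monoˡ-≤ (fall n (d + 1 + m) 2)
                                                                     (fall-bound 1 m d<k 2k+1≤n (s≤s (m≤n+m m 3)))) ⟩
    (q ∸ 1) * (fall n (d + 1) m * fall n (d + 1 + m) 2)         ≡⟨ cong ((q ∸ 1) *_) (fall-+ n (d + 1) m 2) ⟨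
    (q ∸ 1) * fall n (d + 1) (m + 2)                            ≡⟨ cong₂ (λ a b → (q ∸ 1) * fall n a b) (+-comm d 1) (+-comm m 2) ⟩
    (q ∸ 1) * fall n (suc d) (2 + m)                            ≤⟨ *-monoˡ-≤ (fall n (suc d) (2 + m)) (m≤m*n (q ∸ 1) ((q ∸ 1) ^ (2 + m)) {{m^n≢0 (q ∸ 1) (2 + m)}}) ⟩
    (q ∸ 1) ^ k * fall n (suc d) (2 + m)                        ∎
    where
    open ≤-Reasoning
    y = q ^ k ∸ 1
    g = q ^ m
    Q = q ^ k
    shuffle₁ : ∀ a b c e → a * b * (c * e) ≡ (b * c) * (a * e)
    shuffle₁ = solve-∀
    shuffle₂ : ∀ a b p g f → (a * b) * (p * g * f) ≡ p * ((g * a) * b * f)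
    shuffle₂ = solve-∀

    gap≤ : ∀ a b x → a + b ≤ n → x ≤ a → q ^ a * (q ^ b ∸ 1) ≤ q ^ n ∸ q ^ x
    gap≤ a b x a+b≤n x≤a = ≤-trans (≤-reflexive (sym (gap a b))) (∸-mono (^-monoʳ-≤ q a+b≤n) (^-monoʳ-≤ q x≤a))

    split : ∀ x → 1 ≤ x → x * x ∸ 1 ≡ (x ∸ 1) * (x + 1)
    split (suc w) _ = identity w
      where
      identity : ∀ w → w + w * suc w ≡ w * (suc w + 1)
      identity = solve-∀

    -- For x = q² and z = q³, `z * x ≤ (z ∸ 1) * (x + 1)` amounts to x < z; and (q² + 1)(q² - 1) =
    -- q⁴ - 1.
    q^5-bound : q ^ 5 * (q ^ 2 ∸ 1) ≤ (q ^ 3 ∸ 1) * (q ^ 4 ∸ 1)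
    q^5-bound = begin
      q ^ 5 * (q ^ 2 ∸ 1)                          ≡⟨ cong (_* (q ^ 2 ∸ 1)) (^-distribˡ-+-* q 3 2) ⟩
      q ^ 3 * q ^ 2 * (q ^ 2 ∸ 1)                  ≤⟨ *-monoˡ-≤ (q ^ 2 ∸ 1) (z-bound (q ^ 3) (^-monoʳ-< q 2≤q {2} {3} ≤-refl)) ⟩
      (q ^ 3 ∸ 1) * (q ^ 2 + 1) * (q ^ 2 ∸ 1)      ≡⟨ *-assoc (q ^ 3 ∸ 1) _ _ ⟩
      (q ^ 3 ∸ 1) * ((q ^ 2 + 1) * (q ^ 2 ∸ 1))    ≡⟨ cong ((q ^ 3 ∸ 1) *_) (*-comm (q ^ 2 + 1) _) ⟩
      (q ^ 3 ∸ 1) * ((q ^ 2 ∸ 1) * (q ^ 2 + 1))    ≡⟨ cong ((q ^ 3 ∸ 1) *_) (split (q ^ 2) (1≤q^ 2)) ⟨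
      (q ^ 3 ∸ 1) * (q ^ 2 * q ^ 2 ∸ 1)            ≡⟨ cong (λ z → (q ^ 3 ∸ 1) * (z ∸ 1)) (^-distribˡ-+-* q 2 2) ⟨
      (q ^ 3 ∸ 1) * (q ^ 4 ∸ 1)                    ∎
      where
      z-bound : ∀ z → q ^ 2 < z → z * q ^ 2 ≤ (z ∸ 1) * (q ^ 2 + 1)
      z-bound (suc z) (s≤s q²≤z) = begin
        q ^ 2 + z * q ^ 2      ≤⟨ +-monoˡ-≤ (z * q ^ 2) q²≤z ⟩
        z + z * q ^ 2          ≡⟨ identity z (q ^ 2) ⟩
        z * (q ^ 2 + 1)        ∎
        where
        identity : ∀ z x → z + z * x ≡ z * (x + 1)
        identity = solve-∀

    -- The two factors of `fall k` are powers of `q` times q² - 1 and q - 1. Once `y` is enlarged to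
    -- `Q`, `q^5-bound` introduces q³ - 1 and q⁴ - 1, and the remaining powers combine into q^(2k+1)
    -- - q^(3+2m) and q^(2k+1) - q^(4+2m), each at most its factor of `fall n`.
    last-two : y ^ 3 * fall k (1 + m) 2 ≤ (q ∸ 1) * g * fall n (d + 1 + m) 2
    last-two = begin
      y ^ 3 * fall k (1 + m) 2
        ≤⟨ *-monoˡ-≤ (fall k (1 + m) 2) (^-monoˡ-≤ 3 (m∸n≤m Q 1)) ⟩
      Q ^ 3 * fall k (1 + m) 2
        ≡⟨ cong₂ (λ x z → Q ^ 3 * (x * (z * 1)))
             (trans (cong (λ z → q ^ z ∸ q ^ (1 + m)) (cong suc (+-comm 2 m))) (gap (1 + m) 2))
             (trans (cong (λ z → q ^ z ∸ q ^ (2 + m)) (cong (λ z → suc (suc z)) (+-comm 1 m))) (gap (2 + m) 1)) ⟩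
      Q ^ 3 * (q ^ (1 + m) * (q ^ 2 ∸ 1) * (q ^ (2 + m) * (q ^ 1 ∸ 1) * 1))
        ≡⟨ collect q g (q ^ 1 ∸ 1) (q ^ 2 ∸ 1) ⟩
      (q ^ 1 ∸ 1) * g * (q ^ 7 * (g ^ 4)) * (q ^ 5 * (q ^ 2 ∸ 1))
        ≤⟨ *-monoʳ-≤ ((q ^ 1 ∸ 1) * g * (q ^ 7 * (g ^ 4))) q^5-bound ⟩
      (q ^ 1 ∸ 1) * g * (q ^ 7 * (g ^ 4)) * ((q ^ 3 ∸ 1) * (q ^ 4 ∸ 1))
        ≡⟨ distribute q g (q ^ 1 ∸ 1) (q ^ 3 ∸ 1) (q ^ 4 ∸ 1) ⟩
      (q ^ 1 ∸ 1) * g * ((q ^ 3 * (g * g)) * (q ^ 4 ∸ 1) * ((q ^ 4 * (g * g)) * (q ^ 3 ∸ 1) * 1))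
        ≡⟨ cong₂ (λ p z → p * g * z) (cong (_∸ 1) (*-identityʳ q))
             (cong₂ (λ x z → x * (q ^ 4 ∸ 1) * (z * (q ^ 3 ∸ 1) * 1)) (power 3) (power 4)) ⟩
      (q ∸ 1) * g * (q ^ (3 + (m + m)) * (q ^ 4 ∸ 1) * (q ^ (4 + (m + m)) * (q ^ 3 ∸ 1) * 1))
        ≤⟨ *-monoʳ-≤ ((q ∸ 1) * g) (*-mono-≤ (gap≤ (3 + (m + m)) 4 (d + 1 + m) (≤-trans (≤-reflexive (exponent₃ m)) 2k+1≤n) d₃)
             (*-monoˡ-≤ 1 (gap≤ (4 + (m + m)) 3 (suc (d + 1 + m)) (≤-trans (≤-reflexive (exponent₄ m)) 2k+1≤n) (s≤s d₃)))) ⟩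
      (q ∸ 1) * g * fall n (d + 1 + m) 2                                              ∎
      where
      power : ∀ i → q ^ i * (g * g) ≡ q ^ (i + (m + m))
      power i = sym (trans (^-distribˡ-+-* q i (m + m)) (cong (q ^ i *_) (^-distribˡ-+-* q m m)))
      exponent₃ : ∀ m → 3 + (m + m) + 4 ≡ 2 * (3 + m) + 1
      exponent₃ = solve-∀
      exponent₄ : ∀ m → 4 + (m + m) + 3 ≡ 2 * (3 + m) + 1
      exponent₄ = solve-∀
      d₃ : d + 1 + m ≤ 3 + (m + m)
      d₃ = +-monoˡ-≤ m (≤-trans (≤-reflexive (+-comm d 1)) d<k)
      collect : ∀ q g p r → ((q * (q * (q * g))) * ((q * (q * (q * g))) * ((q * (q * (q * g))) * 1))) * ((q * g) * r * ((q * (q * g)) * p * 1)) ≡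
        p * g * ((q * (q * (q * (q * (q * (q * (q * 1))))))) * (g * (g * (g * (g * 1))))) * ((q * (q * (q * (q * (q * 1))))) * r)
      collect = solve-∀
      distribute : ∀ q g p a b → p * g * ((q * (q * (q * (q * (q * (q * (q * 1))))))) * (g * (g * (g * (g * 1))))) * (a * b) ≡
        p * g * (((q * (q * (q * 1))) * (g * g)) * b * (((q * (q * (q * (q * 1)))) * (g * g)) * a * 1))
      distribute = solve-∀

  -- Gaussian binomials as quotients of such products.

  prodUpTo-* : ∀ e f g → prodUpTo e f * prodUpTo e g ≡ prodUpTo e (λ i → f i * g i)
  prodUpTo-* zero    f g = refl
  prodUpTo-* (suc e) f g = trans (*-interchange (prodUpTo e f) (f e) _ _) (cong (_* (f e * g e)) (prodUpTo-* e f g))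

  prodUpTo-fall : ∀ m a e f → (∀ i → i < e → f i ≡ q ^ m ∸ q ^ (a + i)) → prodUpTo e f ≡ fall m a e
  prodUpTo-fall m a zero    f h = refl
  prodUpTo-fall m a (suc e) f h = begin
    prodUpTo e f * f e                                ≡⟨ cong₂ _*_ (prodUpTo-fall m a e f (λ i i<e → h i (m<n⇒m<1+n i<e))) (h e ≤-refl) ⟩
    fall m a e * (q ^ m ∸ q ^ (a + e))                ≡⟨ cong (fall m a e *_) (*-identityʳ _) ⟨
    fall m a e * fall m (a + e) 1                     ≡⟨ fall-+ m a e 1 ⟨
    fall m a (e + 1)                                  ≡⟨ cong (fall m a) (+-comm e 1) ⟩
    fall m a (suc e)                                  ∎
    where open ≡-Reasoning

  prodUpTo-gauss : ∀ a e x → e ≤ x →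
    prodUpTo e (λ i → q ^ (a + i)) * prodUpTo e (λ i → q ^ (x ∸ i) ∸ 1) ≡ fall (a + x) a e
  prodUpTo-gauss a e x e≤x = trans (prodUpTo-* e _ _) (prodUpTo-fall (a + x) a e _ factor)
    where
    factor : ∀ i → i < e → q ^ (a + i) * (q ^ (x ∸ i) ∸ 1) ≡ q ^ (a + x) ∸ q ^ (a + i)
    factor i i<e = trans (sym (gap (a + i) (x ∸ i)))
      (cong (λ z → q ^ z ∸ q ^ (a + i)) (trans (+-assoc a i (x ∸ i)) (cong (a +_) (m+[n∸m]≡n (≤-trans (<⇒≤ i<e) e≤x)))))

  prodUpTo-pos : ∀ e f → (∀ i → i < e → 0 < f i) → 0 < prodUpTo e f
  prodUpTo-pos zero    f h = s≤s z≤n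
  prodUpTo-pos (suc e) f h = *-mono-< (prodUpTo-pos e f (λ i i<e → h i (m<n⇒m<1+n i<e))) (h e ≤-refl)

  -- Scaling numerator and denominator of the Gaussian binomial by the same `powers` turns them into
  -- `fall n (suc d) e` and `fall (suc d + e) (suc d) e`, so the hypothesis becomes an inequality
  -- without division.
  gauss<⇒fall< : ∀ {n} d e x → suc d + e ≤ n → gaussBinom q (n ∸ d ∸ 1) e < x →
    fall n (suc d) e < x * fall (suc d + e) (suc d) e
  gauss<⇒fall< {n} d e x 1+d+e≤n g<x = begin-strict
    fall n (suc d) e                     ≡⟨ cong (λ z → fall z (suc d) e) (m+[n∸m]≡n 1+d≤n) ⟨
    fall (suc d + r) (suc d) e           ≡⟨ prodUpTo-gauss (suc d) e r e≤r ⟨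
    powers * num r                       <⟨ *-monoʳ-< powers {{>-nonZero (prodUpTo-pos e _ (λ i _ → 1≤q^ (suc d + i)))}} num<x*den ⟩
    powers * (x * num e)                 ≡⟨ swap powers x (num e) ⟩
    x * (powers * num e)                 ≡⟨ cong (x *_) (prodUpTo-gauss (suc d) e e ≤-refl) ⟩
    x * fall (suc d + e) (suc d) e       ∎
    where
    open ≤-Reasoning
    r = n ∸ suc d
    num : ℕ → ℕ
    num y = prodUpTo e (λ i → q ^ (y ∸ i) ∸ 1)
    powers = prodUpTo e (λ i → q ^ (suc d + i))
    1+d≤n : suc d ≤ n
    1+d≤n = m+n≤o⇒m≤o (suc d) 1+d+e≤n
    e≤r : e ≤ r
    e≤r = m+n≤o⇒m≤o∸n e (≤-trans (≤-reflexive (+-comm e (suc d))) 1+d+e≤n)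
    num<x*den : num r < x * num e
    num<x*den = <-safeDiv⇒< (num r) (num e) x
      (prodUpTo-pos e _ (λ i i<e → m<n⇒0<n∸m (^-monoʳ-< q 2≤q (m<n⇒0<n∸m i<e))))
      (subst (λ z → safeDiv (num z) (num e) < x) (trans (∸-+-assoc n d 1) (cong (n ∸_) (+-comm d 1))) g<x)
    swap : ∀ a b c → a * (b * c) ≡ b * (a * c)
    swap = solve-∀

-- Finite sums over lists.

private variable
  α β γ : Set

∑ : List α → (α → ℕ) → ℕ
∑ []       f = 0
∑ (x ∷ xs) f = f x + ∑ xs f

∑-mono : ∀ (xs : List α) {f g} → (∀ x → x ∈ xs → f x ≤ g x) → ∑ xs f ≤ ∑ xs g
∑-mono []       h = z≤n
∑-mono (x ∷ xs) h = +-mono-≤ (h x (here refl)) (∑-mono xs (λ y y∈ → h y (there y∈)))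

∑-cong : ∀ (xs : List α) {f g} → (∀ x → f x ≡ g x) → ∑ xs f ≡ ∑ xs g
∑-cong []       h = refl
∑-cong (x ∷ xs) h = cong₂ _+_ (h x) (∑-cong xs h)

∑-0 : ∀ (xs : List α) → ∑ xs (λ _ → 0) ≡ 0
∑-0 []       = refl
∑-0 (x ∷ xs) = ∑-0 xs

∑-+ : ∀ (xs : List α) f g → ∑ xs (λ x → f x + g x) ≡ ∑ xs f + ∑ xs g
∑-+ []       f g = refl
∑-+ (x ∷ xs) f g = trans (cong (f x + g x +_) (∑-+ xs f g)) (+-interchange (f x) (g x) (∑ xs f) (∑ xs g))

*-distribˡ-∑ : ∀ c (xs : List α) f → c * ∑ xs f ≡ ∑ xs (λ x → c * f x)
*-distribˡ-∑ c []       f = *-zeroʳ c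
*-distribˡ-∑ c (x ∷ xs) f = trans (*-distribˡ-+ c (f x) (∑ xs f)) (cong (c * f x +_) (*-distribˡ-∑ c xs f))

*-distribʳ-∑ : ∀ c (xs : List α) f → ∑ xs f * c ≡ ∑ xs (λ x → f x * c)
*-distribʳ-∑ c xs f = trans (*-comm (∑ xs f) c) (trans (*-distribˡ-∑ c xs f) (∑-cong xs (λ x → *-comm c (f x))))

∑-swap : ∀ (xs : List α) (ys : List β) (f : α → β → ℕ) → ∑ xs (λ x → ∑ ys (f x)) ≡ ∑ ys (λ y → ∑ xs (λ x → f x y))
∑-swap []       ys f = sym (∑-0 ys)
∑-swap (x ∷ xs) ys f = trans (cong (∑ ys (f x) +_) (∑-swap xs ys f)) (sym (∑-+ ys (f x) _))

∑-++ : ∀ (xs ys : List α) f → ∑ (xs ++ ys) f ≡ ∑ xs f + ∑ ys f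
∑-++ []       ys f = refl
∑-++ (x ∷ xs) ys f = trans (cong (f x +_) (∑-++ xs ys f)) (sym (+-assoc (f x) _ _))

∑-map : ∀ (g : α → β) xs f → ∑ (map g xs) f ≡ ∑ xs (f ∘ g)
∑-map g []       f = refl
∑-map g (x ∷ xs) f = cong (f (g x) +_) (∑-map g xs f)

∑-cartesianProductWith : ∀ (g : α → β → γ) xs ys f →
  ∑ (cartesianProductWith g xs ys) f ≡ ∑ xs (λ x → ∑ ys (λ y → f (g x y)))
∑-cartesianProductWith g []       ys f = refl
∑-cartesianProductWith g (x ∷ xs) ys f =
  trans (∑-++ (map (g x) ys) _ f) (cong₂ _+_ (∑-map (g x) ys f) (∑-cartesianProductWith g xs ys f))

∑-pos : ∀ (xs : List α) f → 0 < ∑ xs f → ∃ λ x → x ∈ xs × 0 < f x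
∑-pos (x ∷ xs) f 0<∑ with f x in eq
... | suc _ = x , here refl , ≤-trans (s≤s z≤n) (≤-reflexive (sym eq))
... | zero with y , y∈ , 0<fy ← ∑-pos xs f 0<∑ = y , there y∈ , 0<fy

∑-tabulate : ∀ {m} (g : Fin m → α) f → ∑ (List.tabulate g) f ≡ Sum.sum (f ∘ g)
∑-tabulate {m = zero}  g f = refl
∑-tabulate {m = suc m} g f = cong (f (g Fin.zero) +_) (∑-tabulate (g ∘ Fin.suc) f)

∑-permute : ∀ {m} (π : Permutation m m) f → ∑ (allFin m) (λ x → f (π ⟨$⟩ʳ x)) ≡ ∑ (allFin m) f
∑-permute {m} π f = trans (∑-tabulate {m = m} id (λ x → f (π ⟨$⟩ʳ x))) (trans (sym (Sum.sum-permute f π)) (sym (∑-tabulate id f)))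

∑-allFin-const : ∀ m c → ∑ (allFin m) (λ _ → c) ≡ m * c
∑-allFin-const m c = trans (∑-tabulate {m = m} id _) (constant m)
  where
  constant : ∀ m → Sum.sum {m} (λ _ → c) ≡ m * c
  constant zero    = refl
  constant (suc m) = cong (c +_) (constant m)

ind : Bool → ℕ
ind true  = 1
ind false = 0

ind-mono : ∀ {a b} → (a ≡ true → b ≡ true) → ind a ≤ ind b
ind-mono {false} h = z≤n
ind-mono {true}  h rewrite h refl = ≤-refl

∧-true : ∀ {a b} → a ∧ b ≡ true → a ≡ true × b ≡ true
∧-true {true} {true} refl = refl , refl

∧-intro : ∀ {a b} → a ≡ true → b ≡ true → a ∧ b ≡ true
∧-intro refl refl = refl

true≢false : ∀ {a} → a ≡ true → ¬ a ≡ false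
true≢false refl ()

∑-zero : ∀ (xs : List α) f → (∀ x → x ∈ xs → f x ≡ 0) → ∑ xs f ≡ 0
∑-zero []       f h = refl
∑-zero (x ∷ xs) f h = cong₂ _+_ (h x (here refl)) (∑-zero xs f (λ y y∈ → h y (there y∈)))

-- Uniqueness in summed form. `R` will be inequality for vectors and scalars, and difference as sets
-- for members of the family.
∑-ind≤1 : ∀ {R : α → α → Set} (xs : List α) (P : α → Bool) → AllPairs R xs →
  (∀ x y → x ∈ xs → y ∈ xs → P x ≡ true → P y ≡ true → ¬ R x y) → ∑ xs (λ x → ind (P x)) ≤ 1
∑-ind≤1 []       P []        h = z≤n
∑-ind≤1 (x ∷ xs) P (Rx ∷ Rxs) h with P x in Px
... | false = ∑-ind≤1 xs P Rxs (λ y z y∈ z∈ → h y z (there y∈) (there z∈))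
... | true  = s≤s (≤-reflexive (∑-zero xs _ (λ y y∈ → cong ind (Bool.¬-not (λ Py →
                h x y (here refl) (there y∈) Px Py (All.lookup Rx y∈))))))

∑-∈ : ∀ {xs : List α} {x} f → x ∈ xs → f x ≤ ∑ xs f
∑-∈ f (here refl) = m≤m+n _ _
∑-∈ f (there x∈)  = ≤-trans (∑-∈ f x∈) (m≤n+m _ _)

∑-strict : ∀ {xs : List α} {x} f g → (∀ y → f y ≤ g y) → x ∈ xs → f x < g x → ∑ xs f < ∑ xs g
∑-strict {xs = _ ∷ xs} f g f≤g (here refl) fx<gx = +-mono-<-≤ fx<gx (∑-mono xs (λ y _ → f≤g y))
∑-strict {xs = y ∷ xs} f g f≤g (there x∈)  fx<gx = +-mono-≤-< (f≤g y) (∑-strict f g f≤g x∈ fx<gx)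

-- Sums over all vectors over a finite field.

module Vectors {q : ℕ} (𝔽 : FiniteField q) where
  open FiniteField 𝔽 using (0#; 1#; 0≢1; isCommutativeRing) renaming (_+_ to _⊕_; -_ to ⊖_)
  open IsCommutativeRing isCommutativeRing using ()
    renaming (+-assoc to ⊕-assoc; +-identityʳ to ⊕-identityʳ; -‿inverseˡ to ⊖-inverseˡ; -‿inverseʳ to ⊖-inverseʳ)

  2≤q : 2 ≤ q
  2≤q = two q 0# 1# 0≢1
    where
    two : ∀ q (x y : Fin q) → x ≢ y → 2 ≤ q
    two (suc zero) Fin.zero Fin.zero x≢y = contradiction refl x≢y
    two (suc (suc q)) _ _ _ = s≤s (s≤s z≤n)

  open Falling q 2≤q public

  allV : ∀ n → List (Vec (Fin q) n)
  allV zero    = [] ∷ []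
  allV (suc n) = cartesianProductWith _∷_ (allFin q) (allV n)

  ∈-allV : ∀ {n} (v : Vec (Fin q) n) → v ∈ allV n
  ∈-allV []      = here refl
  ∈-allV (x ∷ v) = ∈-cartesianProductWith⁺ _∷_ (∈-allFin x) (∈-allV v)

  ∑-allV-const : ∀ n c → ∑ (allV n) (λ _ → c) ≡ q ^ n * c
  ∑-allV-const zero    c = refl
  ∑-allV-const (suc n) c = begin
    ∑ (allV (suc n)) (λ _ → c)                       ≡⟨ ∑-cartesianProductWith _∷_ (allFin q) (allV n) _ ⟩
    ∑ (allFin q) (λ _ → ∑ (allV n) (λ _ → c))        ≡⟨ ∑-allFin-const q _ ⟩
    q * ∑ (allV n) (λ _ → c)                         ≡⟨ cong (q *_) (∑-allV-const n c) ⟩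
    q * (q ^ n * c)                                  ≡⟨ *-assoc q (q ^ n) c ⟨
    q * q ^ n * c                                    ∎
    where open ≡-Reasoning

  translate : Fin q → Permutation q q
  translate c = permutation (_⊕ c) (_⊕ (⊖ c))
    (λ x → trans (⊕-assoc x _ c) (trans (cong (x ⊕_) (⊖-inverseˡ c)) (⊕-identityʳ x)))
    (λ x → trans (⊕-assoc x c _) (trans (cong (x ⊕_) (⊖-inverseʳ c)) (⊕-identityʳ x)))

  -- In each coordinate, adding a constant permutes the field, so the sum is only reordered. Hence
  -- all translates of a span have the same size.
  ∑-translate : ∀ {n} (w : Vec (Fin q) n) f → ∑ (allV n) (λ v → f (zipWith _⊕_ v w)) ≡ ∑ (allV n) f
  ∑-translate []      f = refl
  ∑-translate {suc n} (c ∷ w) f = begin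
    ∑ (allV (suc n)) (λ v → f (zipWith _⊕_ v (c ∷ w)))
      ≡⟨ ∑-cartesianProductWith _∷_ (allFin q) (allV n) _ ⟩
    ∑ (allFin q) (λ x → ∑ (allV n) (λ v → f ((x ⊕ c) ∷ zipWith _⊕_ v w)))
      ≡⟨ ∑-cong (allFin q) (λ x → ∑-translate w (λ v → f ((x ⊕ c) ∷ v))) ⟩
    ∑ (allFin q) (λ x → ∑ (allV n) (λ v → f ((x ⊕ c) ∷ v)))
      ≡⟨ ∑-permute (translate c) (λ x → ∑ (allV n) (λ v → f (x ∷ v))) ⟩
    ∑ (allFin q) (λ x → ∑ (allV n) (λ v → f (x ∷ v)))
      ≡⟨ ∑-cartesianProductWith _∷_ (allFin q) (allV n) f ⟨
    ∑ (allV (suc n)) f ∎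
    where open ≡-Reasoning

-- Linear algebra with lists of vectors.

module Linear {q : ℕ} (𝔽 : FiniteField q) (n : ℕ) where
  open FiniteField 𝔽 renaming (_+_ to _⊕_; _*_ to _⊗_; -_ to ⊖_)
  open IsCommutativeRing isCommutativeRing using ()
    renaming (+-assoc to ⊕-assoc; +-comm to ⊕-comm; +-identityˡ to ⊕-identityˡ; +-identityʳ to ⊕-identityʳ
             ; -‿inverseˡ to ⊖-inverseˡ; -‿inverseʳ to ⊖-inverseʳ; *-assoc to ⊗-assoc; *-comm to ⊗-comm
             ; *-identityˡ to ⊗-identityˡ; distribˡ to ⊗-distribˡ-⊕; distribʳ to ⊗-distribʳ-⊕
             ; zeroˡ to ⊗-zeroˡ; zeroʳ to ⊗-zeroʳ)
  open Vectors 𝔽 public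
  open Space 𝔽 n

  +V-assoc : ∀ u v w → (u +V v) +V w ≡ u +V (v +V w)
  +V-assoc = VecP.zipWith-assoc ⊕-assoc

  +V-comm : ∀ u v → u +V v ≡ v +V u
  +V-comm = VecP.zipWith-comm ⊕-comm

  +V-identityʳ : ∀ v → v +V zeroV ≡ v
  +V-identityʳ = VecP.zipWith-identityʳ ⊕-identityʳ

  +V-identityˡ : ∀ v → zeroV +V v ≡ v
  +V-identityˡ = VecP.zipWith-identityˡ ⊕-identityˡ

  ·V-distribˡ : ∀ c u v → c ·V (u +V v) ≡ (c ·V u) +V (c ·V v)
  ·V-distribˡ c = go
    where
    go : ∀ {m} (u v : Vec (Fin q) m) → Vec.map (c ⊗_) (zipWith _⊕_ u v) ≡ zipWith _⊕_ (Vec.map (c ⊗_) u) (Vec.map (c ⊗_) v)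
    go []      []      = refl
    go (x ∷ u) (y ∷ v) = cong₂ _∷_ (⊗-distribˡ-⊕ c x y) (go u v)

  ·V-distribʳ : ∀ v c d → (c ⊕ d) ·V v ≡ (c ·V v) +V (d ·V v)
  ·V-distribʳ v c d = go v
    where
    go : ∀ {m} (v : Vec (Fin q) m) → Vec.map ((c ⊕ d) ⊗_) v ≡ zipWith _⊕_ (Vec.map (c ⊗_) v) (Vec.map (d ⊗_) v)
    go []      = refl
    go (x ∷ v) = cong₂ _∷_ (⊗-distribʳ-⊕ x c d) (go v)

  ·V-assoc : ∀ c d v → (c ⊗ d) ·V v ≡ c ·V (d ·V v)
  ·V-assoc c d v = trans (VecP.map-cong (⊗-assoc c d) v) (VecP.map-∘ (c ⊗_) (d ⊗_) v)

  ·V-identityˡ : ∀ v → 1# ·V v ≡ v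
  ·V-identityˡ v = trans (VecP.map-cong ⊗-identityˡ v) (VecP.map-id v)

  ·V-zeroˡ : ∀ v → 0# ·V v ≡ zeroV
  ·V-zeroˡ v = trans (VecP.map-cong ⊗-zeroˡ v) (VecP.map-const v 0#)

  ·V-zeroʳ : ∀ c → c ·V zeroV ≡ zeroV
  ·V-zeroʳ c = trans (VecP.map-replicate (c ⊗_) 0# n) (cong (Vec.replicate n) (⊗-zeroʳ c))

  +V-interchange : ∀ a b c d → (a +V b) +V (c +V d) ≡ (a +V c) +V (b +V d)
  +V-interchange a b c d = begin
    (a +V b) +V (c +V d)   ≡⟨ +V-assoc a b (c +V d) ⟩
    a +V (b +V (c +V d))   ≡⟨ cong (a +V_) (+V-assoc b c d) ⟨
    a +V ((b +V c) +V d)   ≡⟨ cong (λ z → a +V (z +V d)) (+V-comm b c) ⟩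
    a +V ((c +V b) +V d)   ≡⟨ cong (a +V_) (+V-assoc c b d) ⟩
    a +V (c +V (b +V d))   ≡⟨ +V-assoc a c (b +V d) ⟨
    (a +V c) +V (b +V d)   ∎
    where open ≡-Reasoning

  ·V-cancelʳ : ∀ c b → (c ·V b) +V ((⊖ c) ·V b) ≡ zeroV
  ·V-cancelʳ c b = trans (sym (·V-distribʳ b c (⊖ c))) (trans (cong (_·V b) (⊖-inverseʳ c)) (·V-zeroˡ b))

  ·V-cancelˡ : ∀ c b → ((⊖ c) ·V b) +V (c ·V b) ≡ zeroV
  ·V-cancelˡ c b = trans (+V-comm _ _) (·V-cancelʳ c b)

  +V-cancel : ∀ v c b → (v +V (c ·V b)) +V ((⊖ c) ·V b) ≡ v
  +V-cancel v c b = trans (+V-assoc v _ _) (trans (cong (v +V_) (·V-cancelʳ c b)) (+V-identityʳ v))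

  record IsSubspace (S : Subset) : Set where
    field
      0∈ : zeroV ∈V S
      +∈ : ∀ {u v} → u ∈V S → v ∈V S → (u +V v) ∈V S
      ·∈ : ∀ c {v} → v ∈V S → (c ·V v) ∈V S

    cancel∈ : ∀ {v} c {b} → (v +V (c ·V b)) ∈V S → b ∈V S → v ∈V S
    cancel∈ {v} c {b} v+cb∈ b∈ = subst (_∈V S) (+V-cancel v c b) (+∈ v+cb∈ (·∈ (⊖ c) b∈))

    ·∈⁻¹ : ∀ c {v} → c ≢ 0# → (c ·V v) ∈V S → v ∈V S
    ·∈⁻¹ c {v} c≢0 cv∈ with c⁻¹ , cc⁻¹≡1 ← inverse c c≢0 =
      subst (_∈V S) (trans (sym (·V-assoc c⁻¹ c v)) (trans (cong (_·V v) (trans (⊗-comm c⁻¹ c) cc⁻¹≡1)) (·V-identityˡ v)))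
        (·∈ c⁻¹ cv∈)

    -- The difference of the two vectors is (c - d) b. Unless c = d, this scalar can be inverted and
    -- `b` itself lies in `S`. It is the uniqueness of the coordinate along `b` modulo `S`.
    translate-injective : ∀ {v} {b} c d → (v +V (c ·V b)) ∈V S → (v +V (d ·V b)) ∈V S → S b ≡ false → c ≡ d
    translate-injective {v} {b} c d c∈ d∈ b∉ with c Fin.≟ d
    ... | yes c≡d = c≡d
    ... | no  c≢d = contradiction b∉ (true≢false (·∈⁻¹ (c ⊕ (⊖ d)) c-d≢0 (subst (_∈V S) difference (+∈ c∈ (·∈ (⊖ 1#) d∈)))))
      where
      open ≡-Reasoning
      c-d≢0 : c ⊕ (⊖ d) ≢ 0#
      c-d≢0 eq = c≢d (begin
        c                       ≡⟨ ⊕-identityʳ c ⟨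
        c ⊕ 0#                  ≡⟨ cong (c ⊕_) (⊖-inverseˡ d) ⟨
        c ⊕ ((⊖ d) ⊕ d)         ≡⟨ ⊕-assoc c (⊖ d) d ⟨
        (c ⊕ (⊖ d)) ⊕ d         ≡⟨ cong (_⊕ d) eq ⟩
        0# ⊕ d                  ≡⟨ ⊕-identityˡ d ⟩
        d                       ∎)
      neg : ∀ x → (⊖ 1#) ⊗ x ≡ ⊖ x
      neg x = begin
        (⊖ 1#) ⊗ x                        ≡⟨ ⊕-identityʳ _ ⟨
        ((⊖ 1#) ⊗ x) ⊕ 0#                 ≡⟨ cong (((⊖ 1#) ⊗ x) ⊕_) (⊖-inverseʳ x) ⟨
        ((⊖ 1#) ⊗ x) ⊕ (x ⊕ (⊖ x))        ≡⟨ ⊕-assoc _ x (⊖ x) ⟨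
        (((⊖ 1#) ⊗ x) ⊕ x) ⊕ (⊖ x)        ≡⟨ cong (λ z → (((⊖ 1#) ⊗ x) ⊕ z) ⊕ (⊖ x)) (⊗-identityˡ x) ⟨
        (((⊖ 1#) ⊗ x) ⊕ (1# ⊗ x)) ⊕ (⊖ x) ≡⟨ cong (_⊕ (⊖ x)) (⊗-distribʳ-⊕ x (⊖ 1#) 1#) ⟨
        (((⊖ 1#) ⊕ 1#) ⊗ x) ⊕ (⊖ x)       ≡⟨ cong (λ z → (z ⊗ x) ⊕ (⊖ x)) (⊖-inverseˡ 1#) ⟩
        (0# ⊗ x) ⊕ (⊖ x)                  ≡⟨ cong (_⊕ (⊖ x)) (⊗-zeroˡ x) ⟩
        0# ⊕ (⊖ x)                        ≡⟨ ⊕-identityˡ (⊖ x) ⟩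
        ⊖ x                               ∎
      difference : (v +V (c ·V b)) +V ((⊖ 1#) ·V (v +V (d ·V b))) ≡ (c ⊕ (⊖ d)) ·V b
      difference = begin
        (v +V (c ·V b)) +V ((⊖ 1#) ·V (v +V (d ·V b)))                 ≡⟨ cong ((v +V (c ·V b)) +V_) (·V-distribˡ (⊖ 1#) v (d ·V b)) ⟩
        (v +V (c ·V b)) +V (((⊖ 1#) ·V v) +V ((⊖ 1#) ·V (d ·V b)))     ≡⟨ +V-interchange v _ _ _ ⟩
        (v +V ((⊖ 1#) ·V v)) +V ((c ·V b) +V ((⊖ 1#) ·V (d ·V b)))     ≡⟨ cong₂ _+V_
              (trans (cong (_+V ((⊖ 1#) ·V v)) (sym (·V-identityˡ v))) (·V-cancelʳ 1# v))
              (cong ((c ·V b) +V_) (trans (sym (·V-assoc (⊖ 1#) d b)) (cong (_·V b) (neg d)))) ⟩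
        zeroV +V ((c ·V b) +V ((⊖ d) ·V b))                             ≡⟨ +V-identityˡ _ ⟩
        (c ·V b) +V ((⊖ d) ·V b)                                        ≡⟨ ·V-distribʳ b c (⊖ d) ⟨
        (c ⊕ (⊖ d)) ·V b                                                ∎

  -- Boolean, as `Subset` demands, with the coefficient found by exhaustive search. Peeling off one
  -- generator at a time makes counting and independence recursive; adding the multiple of `b`
  -- instead of subtracting it only replaces `c` by its negative.
  span : List V → Subset
  span []       v = does (VecP.≡-dec Fin._≟_ v zeroV)
  span (b ∷ bs) v = does (Fin.any? (λ c → span bs (v +V (c ·V b)) Bool.≟ true))

  ∈-span-[] : ∀ {v} → v ∈V span [] → v ≡ zeroV
  ∈-span-[] {v} v∈ with yes v≡0 ← VecP.≡-dec Fin._≟_ v zeroV = v≡0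

  ∈-span-∷⁻ : ∀ {v} b bs → v ∈V span (b ∷ bs) → ∃ λ c → (v +V (c ·V b)) ∈V span bs
  ∈-span-∷⁻ {v} b bs v∈ with yes p ← Fin.any? (λ c → span bs (v +V (c ·V b)) Bool.≟ true) = p

  ∈-span-∷⁺ : ∀ {v} b bs c → (v +V (c ·V b)) ∈V span bs → v ∈V span (b ∷ bs)
  ∈-span-∷⁺ {v} b bs c ∈bs = dec-true (Fin.any? (λ c → span bs (v +V (c ·V b)) Bool.≟ true)) (c , ∈bs)

  open IsSubspace

  span-isSubspace : ∀ bs → IsSubspace (span bs)
  span-isSubspace [] = record
    { 0∈ = 0∈[]
    ; +∈ = λ {u} {v} u∈ v∈ → subst (_∈V span []) (sym (trans (cong₂ _+V_ (∈-span-[] {u} u∈) (∈-span-[] {v} v∈)) (+V-identityʳ zeroV))) 0∈[]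
    ; ·∈ = λ c {v} v∈ → subst (_∈V span []) (sym (trans (cong (c ·V_) (∈-span-[] {v} v∈)) (·V-zeroʳ c))) 0∈[]
    }
    where
    0∈[] : zeroV ∈V span []
    0∈[] = dec-true (VecP.≡-dec Fin._≟_ zeroV zeroV) refl
  span-isSubspace (b ∷ bs) = record
    { 0∈ = ∈-span-∷⁺ b bs 0# (subst (_∈V span bs) (sym (trans (+V-identityˡ _) (·V-zeroˡ b))) (0∈ bs-sub))
    ; +∈ = λ {u} {v} u∈ v∈ → let c , u′ = ∈-span-∷⁻ b bs u∈; d , v′ = ∈-span-∷⁻ b bs v∈ in
        ∈-span-∷⁺ b bs (c ⊕ d) (subst (_∈V span bs)
          (trans (+V-interchange u _ v _) (cong ((u +V v) +V_) (sym (·V-distribʳ b c d)))) (+∈ bs-sub u′ v′))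
    ; ·∈ = λ a {v} v∈ → let c , v′ = ∈-span-∷⁻ b bs v∈ in
        ∈-span-∷⁺ b bs (a ⊗ c) (subst (_∈V span bs)
          (trans (·V-distribˡ a v _) (cong ((a ·V v) +V_) (sym (·V-assoc a c b)))) (·∈ bs-sub a v′))
    }
    where bs-sub = span-isSubspace bs

  span-⊆-∷ : ∀ b bs → span bs ⊆ span (b ∷ bs)
  span-⊆-∷ b bs v v∈ = ∈-span-∷⁺ b bs 0# (subst (_∈V span bs) (sym (trans (cong (v +V_) (·V-zeroˡ b)) (+V-identityʳ v))) v∈)

  head∈span : ∀ b bs → b ∈V span (b ∷ bs)
  head∈span b bs = ∈-span-∷⁺ b bs (⊖ 1#) (subst (_∈V span bs)
    (sym (trans (cong (_+V ((⊖ 1#) ·V b)) (sym (·V-identityˡ b))) (·V-cancelʳ 1# b))) (0∈ (span-isSubspace bs)))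

  all⇒span⊆ : ∀ {S} → IsSubspace S → ∀ us → all S us ≡ true → span us ⊆ S
  all⇒span⊆ {S} sub []       _    v v∈ = subst (_∈V S) (sym (∈-span-[] v∈)) (0∈ sub)
  all⇒span⊆ {S} sub (u ∷ us) all∈ v v∈ with u∈ , us∈ ← ∧-true all∈ | c , v′ ← ∈-span-∷⁻ u us v∈ =
    cancel∈ sub c (all⇒span⊆ sub us us∈ _ v′) u∈

  span⊆⇒all : ∀ {S} us → span us ⊆ S → all S us ≡ true
  span⊆⇒all []       _   = refl
  span⊆⇒all (u ∷ us) us⊆ =
    ∧-intro (us⊆ u (head∈span u us)) (span⊆⇒all us (λ v v∈ → us⊆ v (span-⊆-∷ u us v v∈)))

  span-⊆-++ˡ : ∀ us ts → span ts ⊆ span (us ++ ts)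
  span-⊆-++ˡ []       ts v v∈ = v∈
  span-⊆-++ˡ (u ∷ us) ts v v∈ = span-⊆-∷ u (us ++ ts) v (span-⊆-++ˡ us ts v v∈)

  span-⊆-++ʳ : ∀ us ts → span us ⊆ span (us ++ ts)
  span-⊆-++ʳ us ts = all⇒span⊆ (span-isSubspace (us ++ ts)) us (members us)
    where
    weaken : ∀ u us′ {xs} → all (span xs) us′ ≡ true → all (span (u ∷ xs)) us′ ≡ true
    weaken u []       _ = refl
    weaken u (x ∷ us′) {xs} h with x∈ , h′ ← ∧-true h = ∧-intro (span-⊆-∷ u xs x x∈) (weaken u us′ {xs} h′)
    members : ∀ us → all (span (us ++ ts)) us ≡ true
    members []       = refl
    members (u ∷ us) = ∧-intro (head∈span u (us ++ ts)) (weaken u us {us ++ ts} (members us))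

  -- This form is decided by computation and suits tuples that grow by one vector at the head;
  -- `LinIndep⇒Indep` and `Indep⇒LinIndep` link it to the given notion.
  Indep : List V → Set
  Indep []       = ⊤
  Indep (b ∷ bs) = Indep bs × span bs b ≡ false

  Indep? : ∀ bs → Dec (Indep bs)
  Indep? []       = yes tt
  Indep? (b ∷ bs) = Indep? bs ×-dec (span bs b Bool.≟ false)

  Disjoint : Subset → Subset → Set
  Disjoint S T = ∀ v → v ∈V S → v ∈V T → v ≡ zeroV

  -- For a common vector `v`, both `v +V (c ·V u)` and `v` lie in the span of `us ++ ts`, which
  -- omits `u`; so `c` vanishes and `u` can be removed from the list.
  Indep-++⇒Disjoint : ∀ us ts → Indep (us ++ ts) → Disjoint (span us) (span ts)
  Indep-++⇒Disjoint []       ts _           v v∈us _ = ∈-span-[] v∈us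
  Indep-++⇒Disjoint (u ∷ us) ts (ind′ , u∉) v v∈us v∈ts with c , v′ ← ∈-span-∷⁻ u us v∈us =
    Indep-++⇒Disjoint us ts ind′ v
      (subst (_∈V span us) (trans (cong (λ z → v +V (z ·V u)) c≡0) (trans (cong (v +V_) (·V-zeroˡ u)) (+V-identityʳ v))) v′) v∈ts
    where
    c≡0 : c ≡ 0#
    c≡0 = translate-injective (span-isSubspace (us ++ ts)) c 0# (span-⊆-++ʳ us ts _ v′)
      (span-⊆-++ˡ us ts _ (subst (_∈V span ts) (sym (trans (cong (v +V_) (·V-zeroˡ u)) (+V-identityʳ v))) v∈ts)) u∉

  Indep-[_] : ∀ {v} → v ≢ zeroV → Indep (v ∷ [])
  Indep-[_] {v} v≢0 = tt , Bool.¬-not (λ v∈ → v≢0 (∈-span-[] v∈))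

  span-tabulate : ∀ m (b : Fin m → V) v → (v ∈V span (List.tabulate b)) ⇔ (∃ λ c → lincomb m c b ≡ v)
  span-tabulate m b v = mk⇔ (to m b v) (λ (c , eq) → from m b v c eq)
    where
    to : ∀ m (b : Fin m → V) v → v ∈V span (List.tabulate b) → ∃ λ c → lincomb m c b ≡ v
    to zero    b v v∈ = (λ ()) , sym (∈-span-[] v∈)
    to (suc m) b v v∈ with c , v′ ← ∈-span-∷⁻ {v} (b Fin.zero) (List.tabulate (b ∘ Fin.suc)) v∈ with cs , eq ← to m (b ∘ Fin.suc) _ v′ =
      -- The coefficient found by `span` cancels the `b`-part of `v`, so it enters `lincomb` with
      -- the opposite sign.
      (λ { Fin.zero → ⊖ c; (Fin.suc i) → cs i }) ,
      trans (+V-comm _ _) (trans (cong (_+V ((⊖ c) ·V b Fin.zero)) eq) (+V-cancel v c (b Fin.zero)))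
    from : ∀ m (b : Fin m → V) v c → lincomb m c b ≡ v → v ∈V span (List.tabulate b)
    from zero    b v c eq = subst (_∈V span []) eq (0∈ (span-isSubspace []))
    from (suc m) b v c eq = ∈-span-∷⁺ {v} (b Fin.zero) (List.tabulate (b ∘ Fin.suc)) (⊖ c₀) (subst (_∈V span (List.tabulate (b ∘ Fin.suc)))
      (trans (sym (+V-cancel rest c₀ (b Fin.zero))) (cong (_+V ((⊖ c₀) ·V b Fin.zero)) (trans (+V-comm _ _) eq)))
      (from m (b ∘ Fin.suc) rest (c ∘ Fin.suc) refl))
      where
      c₀ = c Fin.zero
      rest = lincomb m (c ∘ Fin.suc) (b ∘ Fin.suc)

  -- A head vector in the span of the tail gives a relation with leading coefficient -1;
  -- independence would make it 0, hence 0 = 1.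
  LinIndep⇒Indep : ∀ m (b : Fin m → V) → LinIndep m b → Indep (List.tabulate b)
  LinIndep⇒Indep zero    b li = tt
  LinIndep⇒Indep (suc m) b li = LinIndep⇒Indep m (b ∘ Fin.suc) li-tail , Bool.¬-not b₀∉
    where
    b₀ = b Fin.zero
    extend : Fin q → (Fin m → Fin q) → Fin (suc m) → Fin q
    extend c₀ c Fin.zero    = c₀
    extend c₀ c (Fin.suc i) = c i
    li-tail : LinIndep m (b ∘ Fin.suc)
    li-tail c eq i = li (extend 0# c)
      (trans (cong₂ _+V_ (·V-zeroˡ b₀) eq) (+V-identityʳ zeroV)) (Fin.suc i)
    b₀∉ : ¬ (b₀ ∈V span (List.tabulate (b ∘ Fin.suc)))
    b₀∉ b₀∈ with cs , eq ← Equivalence.to (span-tabulate m (b ∘ Fin.suc) b₀) b₀∈ = 0≢1 (begin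
      0#               ≡⟨ ⊖-inverseʳ 1# ⟨
      1# ⊕ (⊖ 1#)      ≡⟨ cong (1# ⊕_) -1≡0 ⟩
      1# ⊕ 0#          ≡⟨ ⊕-identityʳ 1# ⟩
      1#               ∎)
      where
      open ≡-Reasoning
      -1≡0 : ⊖ 1# ≡ 0#
      -1≡0 = li (extend (⊖ 1#) cs)
        (trans (cong (((⊖ 1#) ·V b₀) +V_) (trans eq (sym (·V-identityˡ b₀)))) (·V-cancelˡ 1# b₀)) Fin.zero

  -- Adding `c₀` times `b₀` to `rest` gives zero, and adding nothing gives `rest`; both results lie
  -- in the span of the tail, so `c₀` is zero by uniqueness of the coordinate along `b₀`.
  Indep⇒LinIndep : ∀ m (b : Fin m → V) → Indep (List.tabulate b) → LinIndep m b
  Indep⇒LinIndep (suc m) b (indep , b₀∉) c eq = zeros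
    where
    b₀ = b Fin.zero
    c₀ = c Fin.zero
    rest = lincomb m (c ∘ Fin.suc) (b ∘ Fin.suc)
    sub = span-isSubspace (List.tabulate (b ∘ Fin.suc))
    rest∈ : rest ∈V span (List.tabulate (b ∘ Fin.suc))
    rest∈ = Equivalence.from (span-tabulate m (b ∘ Fin.suc) rest) (c ∘ Fin.suc , refl)
    c₀≡0 : c₀ ≡ 0#
    c₀≡0 = translate-injective sub {rest} {b₀} c₀ 0#
      (subst (_∈V span (List.tabulate (b ∘ Fin.suc))) (sym (trans (+V-comm rest _) eq)) (0∈ sub))
      (subst (_∈V span (List.tabulate (b ∘ Fin.suc))) (sym (trans (cong (rest +V_) (·V-zeroˡ b₀)) (+V-identityʳ rest))) rest∈)
      b₀∉
    zeros : ∀ i → c i ≡ 0#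
    zeros Fin.zero    = c₀≡0
    zeros (Fin.suc i) = Indep⇒LinIndep m (b ∘ Fin.suc) indep (c ∘ Fin.suc)
      (trans (sym (+V-identityˡ rest)) (trans (cong (_+V rest) (sym (trans (cong (_·V b₀) c₀≡0) (·V-zeroˡ b₀)))) eq)) i

  span-isSubspaceOfDim : ∀ us → Indep us → IsSubspaceOfDim (length us) (span us)
  span-isSubspaceOfDim us indep = lookup us ,
    Indep⇒LinIndep (length us) (lookup us) (subst Indep (sym (tabulate-lookup us)) indep) ,
    λ v → subst (λ xs → (v ∈V span xs) ⇔ (∃ λ c → lincomb (length us) c (lookup us) ≡ v)) (tabulate-lookup us)
            (span-tabulate (length us) (lookup us) v)

-- Cardinalities of subspaces.

module Counting {q : ℕ} (𝔽 : FiniteField q) (n : ℕ) where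
  open FiniteField 𝔽 using (0#)
  open Linear 𝔽 n public
  open Space 𝔽 n
  open IsSubspace

  count : Subset → ℕ
  count S = ∑ (allV n) (λ v → ind (S v))

  infixl 6 _∖_
  _∖_ : Subset → Subset → Subset
  (S ∖ T) v = S v ∧ not (T v)

  full : Subset
  full _ = true

  count-full : count full ≡ q ^ n
  count-full = trans (∑-allV-const n 1) (*-identityʳ (q ^ n))

  count-mono : ∀ {S T} → S ⊆ T → count S ≤ count T
  count-mono S⊆T = ∑-mono (allV n) (λ v _ → ind-mono (S⊆T v))

  count-split : ∀ S T → count S ≡ count (S ∩ T) + count (S ∖ T)
  count-split S T = trans (∑-cong (allV n) (λ v → split (S v) (T v))) (∑-+ (allV n) _ _)
    where
    split : ∀ a b → ind a ≡ ind (a ∧ b) + ind (a ∧ not b)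
    split true  true  = refl
    split true  false = refl
    split false b     = refl

  count-⊆⇒⊇ : ∀ {S T} → S ⊆ T → count T ≤ count S → T ⊆ S
  count-⊆⇒⊇ {S} {T} S⊆T |T|≤|S| v v∈T with S v in Sv
  ... | true  = refl
  ... | false = contradiction |T|≤|S| (<⇒≱ (∑-strict _ _ (λ w → ind-mono (S⊆T w)) (∈-allV v) ind<))
    where
    ind< : ind (S v) < ind (T v)
    ind< rewrite Sv | v∈T = s≤s z≤n

  -- The left side counts vectors together with a coefficient witnessing membership in
  -- `span (b ∷ bs)`; each coefficient contributes a translate of `span bs`. A member has at least
  -- one witness, and only one if `b` is outside `span bs`, whence the two bounds on
  -- `count (span us)`.
  count-span-∷ : ∀ b bs → ∑ (allV n) (λ v → ∑ (allFin q) (λ c → ind (span bs (v +V (c ·V b))))) ≡ q * count (span bs)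
  count-span-∷ b bs = begin
    ∑ (allV n) (λ v → ∑ (allFin q) (λ c → ind (span bs (v +V (c ·V b)))))  ≡⟨ ∑-swap (allV n) (allFin q) _ ⟩
    ∑ (allFin q) (λ c → ∑ (allV n) (λ v → ind (span bs (v +V (c ·V b)))))  ≡⟨ ∑-cong (allFin q) (λ c → ∑-translate (c ·V b) (λ v → ind (span bs v))) ⟩
    ∑ (allFin q) (λ _ → count (span bs))                                   ≡⟨ ∑-allFin-const q _ ⟩
    q * count (span bs)                                                    ∎
    where open ≡-Reasoning

  count-span-[] : count (span []) ≡ 1
  count-span-[] = ≤-antisym
    (∑-ind≤1 (allV n) (span []) (allV-unique n) (λ v w _ _ v∈ w∈ v≢w → v≢w (trans (∈-span-[] {v} v∈) (sym (∈-span-[] {w} w∈)))))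
    (≤-trans (≤-reflexive (sym (cong ind (0∈ (span-isSubspace []))))) (∑-∈ (λ v → ind (span [] v)) (∈-allV zeroV)))
    where
    allV-unique : ∀ m → AllPairs _≢_ (allV m)
    allV-unique zero    = All.[] ∷ []
    allV-unique (suc m) = Unique.cartesianProductWith⁺ _∷_ VecP.∷-injective (Unique.allFin⁺ q) (allV-unique m)

  count-span-≤ : ∀ us → count (span us) ≤ q ^ length us
  count-span-≤ []       = ≤-reflexive count-span-[]
  count-span-≤ (b ∷ bs) = begin
    count (span (b ∷ bs))                                                  ≤⟨ ∑-mono (allV n) (λ v _ → pointwise v) ⟩
    ∑ (allV n) (λ v → ∑ (allFin q) (λ c → ind (span bs (v +V (c ·V b)))))  ≡⟨ count-span-∷ b bs ⟩
    q * count (span bs)                                                    ≤⟨ *-monoʳ-≤ q (count-span-≤ bs) ⟩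
    q * q ^ length bs                                                      ∎
    where
    open ≤-Reasoning
    pointwise : ∀ v → ind (span (b ∷ bs) v) ≤ ∑ (allFin q) (λ c → ind (span bs (v +V (c ·V b))))
    pointwise v with span (b ∷ bs) v in eq
    ... | false = z≤n
    ... | true with c , v′ ← ∈-span-∷⁻ {v} b bs eq =
      ≤-trans (≤-reflexive (sym (cong ind v′))) (∑-∈ (λ c → ind (span bs (v +V (c ·V b)))) (∈-allFin c))

  count-span-≥ : ∀ us → Indep us → q ^ length us ≤ count (span us)
  count-span-≥ []       _            = ≤-reflexive (sym count-span-[])
  count-span-≥ (b ∷ bs) (indep , b∉) = begin
    q * q ^ length bs                                                      ≤⟨ *-monoʳ-≤ q (count-span-≥ bs indep) ⟩
    q * count (span bs)                                                    ≡⟨ count-span-∷ b bs ⟨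
    ∑ (allV n) (λ v → ∑ (allFin q) (λ c → ind (span bs (v +V (c ·V b)))))  ≤⟨ ∑-mono (allV n) (λ v _ → pointwise v) ⟩
    count (span (b ∷ bs))                                                  ∎
    where
    open ≤-Reasoning
    pointwise : ∀ v → ∑ (allFin q) (λ c → ind (span bs (v +V (c ·V b)))) ≤ ind (span (b ∷ bs) v)
    pointwise v with span (b ∷ bs) v in eq
    ... | true  = ∑-ind≤1 (allFin q) _ (Unique.allFin⁺ q)
                    (λ c d _ _ c∈ d∈ c≢d → c≢d (translate-injective (span-isSubspace bs) c d c∈ d∈ b∉))
    ... | false = ≤-reflexive (∑-zero (allFin q) _ (λ c _ → cong ind (Bool.¬-not (λ c∈ →
                    true≢false (∈-span-∷⁺ {v} b bs c c∈) eq))))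

  count-span : ∀ us → Indep us → count (span us) ≡ q ^ length us
  count-span us indep = ≤-antisym (count-span-≤ us) (count-span-≥ us indep)

  Indep-++ˡ : ∀ us ts → Indep (us ++ ts) → Indep us
  Indep-++ˡ []       ts _            = tt
  Indep-++ˡ (u ∷ us) ts (indep , u∉) = Indep-++ˡ us ts indep , Bool.¬-not (λ u∈ → true≢false (span-⊆-++ʳ us ts u u∈) u∉)

  record HasDim (k : ℕ) (F : Subset) : Set where
    field
      basis        : List V
      basis-indep  : Indep basis
      basis-length : length basis ≡ k
      basis-span   : SameSet F (span basis)

    isSubspace : IsSubspace F
    isSubspace = record
      { 0∈ = trans (basis-span _) (0∈ sub)
      ; +∈ = λ u∈ v∈ → trans (basis-span _) (+∈ sub (trans (sym (basis-span _)) u∈) (trans (sym (basis-span _)) v∈))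
      ; ·∈ = λ c v∈ → trans (basis-span _) (·∈ sub c (trans (sym (basis-span _)) v∈))
      }
      where sub = span-isSubspace basis

    count≡ : count F ≡ q ^ k
    count≡ = trans (∑-cong (allV n) (λ v → cong ind (basis-span v)))
      (trans (count-span basis basis-indep) (cong (q ^_) basis-length))

  hasDim : ∀ {k F} → IsSubspaceOfDim k F → HasDim k F
  hasDim {k} {F} (b , li , mem) = record
    { basis        = List.tabulate b
    ; basis-indep  = LinIndep⇒Indep k b li
    ; basis-length = length-tabulate b
    ; basis-span   = λ v → bool-ext (λ v∈ → Equivalence.from (span-tabulate k b v) (Equivalence.to (mem v) v∈))
                                    (λ v∈ → Equivalence.from (mem v) (Equivalence.to (span-tabulate k b v) v∈))
    }
    where
    bool-ext : ∀ {x y} → (x ≡ true → y ≡ true) → (y ≡ true → x ≡ true) → x ≡ y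
    bool-ext {true}  {y}     f g = sym (f refl)
    bool-ext {false} {true}  f g = g refl
    bool-ext {false} {false} f g = refl

  -- Under disjointness the first basis vector of the intersection would be zero and so lie in the
  -- span of the others.
  dim≥1⇒¬Disjoint : ∀ {S T} → DimAtLeast 1 (S ∩ T) → ¬ Disjoint S T
  dim≥1⇒¬Disjoint {S} {T} (suc m , _ , b , li , mem) disj
    with b₀∈S , b₀∈T ← ∧-true {S (b Fin.zero)} (Equivalence.from (mem (b Fin.zero))
      (Equivalence.to (span-tabulate (suc m) b (b Fin.zero)) (head∈span (b Fin.zero) (List.tabulate (b ∘ Fin.suc)))))
    = true≢false (subst (_∈V span rest) (sym (disj _ b₀∈S b₀∈T)) (0∈ (span-isSubspace rest))) (proj₂ (LinIndep⇒Indep (suc m) b li))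
    where rest = List.tabulate (b ∘ Fin.suc)

  -- Degrees in an intersecting family, by double counting.

  module Family (ℱ : List Subset) (k : ℕ)
    (dim : ∀ {F} → F ∈ ℱ → HasDim k F)
    (distinct : AllPairs (λ F G → ¬ SameSet F G) ℱ)
    (intersecting : ∀ {F G} → F ∈ ℱ → G ∈ ℱ → ¬ Disjoint F G) where

    open HasDim

    -- A filter on members, so that the same bounds serve the whole family and the members avoiding
    -- a point.
    Weight : Set
    Weight = Subset → Bool

    deg : Weight → List V → ℕ
    deg w us = ∑ ℱ (λ F → ind (w F ∧ all F us))

    -- Both sides count pairs of a vector `a` of `R` and a selected member containing `a` and `us`.
    double-count : ∀ w us R → ∑ (allV n) (λ a → ind (R a) * deg w (a ∷ us)) ≡ ∑ ℱ (λ F → ind (w F ∧ all F us) * count (R ∩ F))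
    double-count w us R = begin
      ∑ (allV n) (λ a → ind (R a) * deg w (a ∷ us))
        ≡⟨ ∑-cong (allV n) (λ a → *-distribˡ-∑ (ind (R a)) ℱ _) ⟩
      ∑ (allV n) (λ a → ∑ ℱ (λ F → ind (R a) * ind (w F ∧ (F a ∧ all F us))))
        ≡⟨ ∑-swap (allV n) ℱ _ ⟩
      ∑ ℱ (λ F → ∑ (allV n) (λ a → ind (R a) * ind (w F ∧ (F a ∧ all F us))))
        ≡⟨ ∑-cong ℱ (λ F → trans (∑-cong (allV n) (λ a → regroup (R a) (w F) (F a) (all F us)))
             (sym (*-distribˡ-∑ (ind (w F ∧ all F us)) (allV n) _))) ⟩
      ∑ ℱ (λ F → ind (w F ∧ all F us) * count (R ∩ F)) ∎
      where
      open ≡-Reasoning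
      regroup : ∀ r x f y → ind r * ind (x ∧ (f ∧ y)) ≡ ind (x ∧ y) * ind (r ∧ f)
      regroup true  true  true  y = trans (+-identityʳ _) (sym (*-identityʳ _))
      regroup true  true  false y = sym (*-zeroʳ (ind y))
      regroup true  false f     y = refl
      regroup false x     f     y = sym (*-zeroʳ (ind (x ∧ y)))

    ind-*-mono : ∀ b {x y} → (b ≡ true → x ≤ y) → ind b * x ≤ ind b * y
    ind-*-mono true  h = *-monoʳ-≤ 1 (h refl)
    ind-*-mono false h = z≤n

    -- Here `M / Y` bounds the degree after one more vector, with numerator and denominator kept
    -- apart to stay in ℕ. Each selected member through `us` is reached through at least `x` vectors
    -- of `R`.
    extend-≤ : ∀ w us R x Y M →
      (∀ F → F ∈ ℱ → w F ≡ true → all F us ≡ true → x ≤ count (R ∩ F)) →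
      (∀ a → a ∈V R → Y * deg w (a ∷ us) ≤ M) →
      x * (Y * deg w us) ≤ count R * M
    extend-≤ w us R x Y M x≤ ≤M = begin
      x * (Y * deg w us)                                         ≡⟨ rotate x Y (deg w us) ⟩
      Y * (deg w us * x)                                         ≡⟨ cong (Y *_) (*-distribʳ-∑ x ℱ _) ⟩
      Y * ∑ ℱ (λ F → ind (w F ∧ all F us) * x)                   ≤⟨ *-monoʳ-≤ Y (∑-mono ℱ (λ F F∈ → ind-*-mono (w F ∧ all F us) (λ h →
                                                                      x≤ F F∈ (proj₁ (∧-true {w F} h)) (proj₂ (∧-true {w F} h))))) ⟩
      Y * ∑ ℱ (λ F → ind (w F ∧ all F us) * count (R ∩ F))       ≡⟨ cong (Y *_) (double-count w us R) ⟨
      Y * ∑ (allV n) (λ a → ind (R a) * deg w (a ∷ us))          ≡⟨ *-distribˡ-∑ Y (allV n) _ ⟩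
      ∑ (allV n) (λ a → Y * (ind (R a) * deg w (a ∷ us)))        ≡⟨ ∑-cong (allV n) (λ a → swap Y (ind (R a)) _) ⟩
      ∑ (allV n) (λ a → ind (R a) * (Y * deg w (a ∷ us)))        ≤⟨ ∑-mono (allV n) (λ a _ → ind-*-mono (R a) (≤M a)) ⟩
      ∑ (allV n) (λ a → ind (R a) * M)                           ≡⟨ *-distribʳ-∑ M (allV n) _ ⟨
      count R * M                                                ∎
      where
      open ≤-Reasoning
      rotate : ∀ a b c → a * (b * c) ≡ b * (c * a)
      rotate = solve-∀
      swap : ∀ a b c → a * (b * c) ≡ b * (a * c)
      swap = solve-∀

    extend-≥ : ∀ w us R x Y M →
      (∀ F → F ∈ ℱ → all F us ≡ true → count (R ∩ F) ≤ x) →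
      (∀ a → a ∈V R → M ≤ Y * deg w (a ∷ us)) →
      count R * M ≤ x * (Y * deg w us)
    extend-≥ w us R x Y M ≤x M≤ = begin
      count R * M                                                ≡⟨ *-distribʳ-∑ M (allV n) _ ⟩
      ∑ (allV n) (λ a → ind (R a) * M)                           ≤⟨ ∑-mono (allV n) (λ a _ → ind-*-mono (R a) (M≤ a)) ⟩
      ∑ (allV n) (λ a → ind (R a) * (Y * deg w (a ∷ us)))        ≡⟨ ∑-cong (allV n) (λ a → swap (ind (R a)) Y _) ⟩
      ∑ (allV n) (λ a → Y * (ind (R a) * deg w (a ∷ us)))        ≡⟨ *-distribˡ-∑ Y (allV n) _ ⟨
      Y * ∑ (allV n) (λ a → ind (R a) * deg w (a ∷ us))          ≡⟨ cong (Y *_) (double-count w us R) ⟩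
      Y * ∑ ℱ (λ F → ind (w F ∧ all F us) * count (R ∩ F))       ≤⟨ *-monoʳ-≤ Y (∑-mono ℱ (λ F F∈ → ind-*-mono (w F ∧ all F us) (λ h →
                                                                      ≤x F F∈ (proj₂ (∧-true {w F} h))))) ⟩
      Y * ∑ ℱ (λ F → ind (w F ∧ all F us) * x)                   ≡⟨ cong (Y *_) (*-distribʳ-∑ x ℱ _) ⟨
      Y * (deg w us * x)                                         ≡⟨ rotate x Y (deg w us) ⟨
      x * (Y * deg w us)                                         ∎
      where
      open ≤-Reasoning
      rotate : ∀ a b c → a * (b * c) ≡ b * (c * a)
      rotate = solve-∀
      swap : ∀ a b c → a * (b * c) ≡ b * (a * c)
      swap = solve-∀

    ∁ : Subset → Subset
    ∁ S = full ∖ S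

    count-∁ : ∀ us → count (∁ (span us)) + count (span us) ≡ q ^ n
    count-∁ us = trans (+-comm _ (count (span us))) (trans (sym (count-split full (span us))) count-full)

    -- A member containing `k` independent vectors contains their span, which has as many vectors as
    -- the member, so the two coincide; and the members are pairwise distinct.
    deg-≤1 : ∀ w us → Indep us → length us ≡ k → deg w us ≤ 1
    deg-≤1 w us indep len = ∑-ind≤1 ℱ _ distinct same
      where
      spanned : ∀ {F} → F ∈ ℱ → all F us ≡ true → SameSet F (span us)
      spanned {F} F∈ h v with F v in Fv | span us v in sv
      ... | true  | true  = refl
      ... | false | false = refl
      ... | false | true  = trans (sym Fv) (all⇒span⊆ (isSubspace (dim F∈)) us h v sv)
      ... | true  | false = trans (sym (count-⊆⇒⊇ (all⇒span⊆ (isSubspace (dim F∈)) us h)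
              (≤-reflexive (trans (count≡ (dim F∈)) (trans (cong (q ^_) (sym len)) (sym (count-span us indep))))) v Fv)) sv
      same : ∀ F G → F ∈ ℱ → G ∈ ℱ → w F ∧ all F us ≡ true → w G ∧ all G us ≡ true → ¬ ¬ SameSet F G
      same F G F∈ G∈ hF hG F≢G = F≢G (λ v → trans (spanned F∈ (proj₂ (∧-true {w F} hF)) v) (sym (spanned G∈ (proj₂ (∧-true {w G} hG)) v)))

    -- With t = `length us`, the two products have the quotient [n-t, k-t], the number of `k`-spaces
    -- through a `t`-space. The count adjoins vectors outside the span one by one.
    deg-bound : ∀ w l us → Indep us → length us + l ≡ k → fall k (length us) l * deg w us ≤ fall n (length us) l
    deg-bound w zero    us indep len = ≤-trans (≤-reflexive (*-identityˡ _)) (deg-≤1 w us indep (trans (sym (+-identityʳ _)) len))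
    deg-bound w (suc l) us indep len = begin
      (q ^ k ∸ q ^ t) * fall k (suc t) l * deg w us    ≡⟨ *-assoc (q ^ k ∸ q ^ t) _ _ ⟩
      (q ^ k ∸ q ^ t) * (fall k (suc t) l * deg w us)  ≤⟨ extend-≤ w us (∁ (span us)) (q ^ k ∸ q ^ t) (fall k (suc t) l) (fall n (suc t) l) outside
                                                           (λ a a∉ → deg-bound w l (a ∷ us) (indep , Bool.¬-not (λ a∈ → true≢false a∉ (cong not a∈)))
                                                                       (trans (sym (+-suc t l)) len)) ⟩
      count (∁ (span us)) * fall n (suc t) l           ≤⟨ *-monoˡ-≤ (fall n (suc t) l) (m+n≤o⇒m≤o∸n (count (∁ (span us))) (≤-reflexive (trans (cong (count (∁ (span us)) +_) (sym (count-span us indep))) (count-∁ us)))) ⟩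
      (q ^ n ∸ q ^ t) * fall n (suc t) l               ∎
      where
      open ≤-Reasoning
      t = length us
      outside : ∀ F → F ∈ ℱ → w F ≡ true → all F us ≡ true → q ^ k ∸ q ^ t ≤ count (∁ (span us) ∩ F)
      outside F F∈ _ _ = m≤n+o⇒m∸n≤o (q ^ k) (q ^ t) (begin
        q ^ k                                             ≡⟨ count≡ (dim F∈) ⟨
        count F                                           ≡⟨ count-split F (span us) ⟩
        count (F ∩ span us) + count (F ∖ span us)         ≤⟨ +-mono-≤ (≤-trans (count-mono (λ v h → proj₂ (∧-true {F v} h))) (count-span-≤ us))
                                                               (count-mono (λ v h → ∧-intro (proj₂ (∧-true {F v} h)) (proj₁ (∧-true {F v} h)))) ⟩
        q ^ t + count (∁ (span us) ∩ F)                   ∎)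

    -- Stated negatively: covers are only used to derive inequalities in ℕ, which are stable under
    -- double negation, so no witness of the intersection is needed.
    Cover : Subset → Set
    Cover C = ∀ {F} → F ∈ ℱ → ¬ Disjoint C F

    -- Branching over covers and averaging around them.

    basis-cover : ∀ {G} (G∈ : G ∈ ℱ) → Cover (span (basis (dim G∈)))
    basis-cover G∈ F∈ disj = intersecting G∈ F∈ (λ v v∈G v∈F → disj v (trans (sym (basis-span (dim G∈) v)) v∈G) v∈F)

    cover-count : ∀ {C F} → IsSubspace C → Cover C → F ∈ ℱ → q ≤ count (C ∩ F)
    cover-count {C} {F} sub cover F∈ = decidable-stable (q ≤? _) (λ q≰ → cover F∈ (λ v v∈C v∈F → decidable-stable (VecP.≡-dec Fin._≟_ v zeroV) (λ v≢0 → q≰ (begin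
      q                     ≡⟨ *-identityʳ q ⟨
      q ^ 1                 ≤⟨ count-span-≥ (v ∷ []) (Indep-[ v≢0 ]) ⟩
      count (span (v ∷ [])) ≤⟨ count-mono (λ u u∈ → ∧-intro (all⇒span⊆ sub (v ∷ []) (∧-intro v∈C refl) u u∈)
                                                            (all⇒span⊆ (isSubspace (dim F∈)) (v ∷ []) (∧-intro v∈F refl) u u∈)) ⟩
      count (C ∩ F)         ∎))))
      where open ≤-Reasoning

    -- A member meets the cover in at least a full line, hence in `q ∸ 1` nonzero vectors, and is
    -- counted once through each of them.
    branch : ∀ w us cs Y M → Indep cs → Cover (span cs) →
      (∀ a → a ∈V span cs → a ≢ zeroV → Y * deg w (a ∷ us) ≤ M) →
      (q ∸ 1) * (Y * deg w us) ≤ (q ^ length cs ∸ 1) * M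
    branch w us cs Y M indep cover ≤M = ≤-trans
      (extend-≤ w us (span cs ∖ span []) (q ∸ 1) Y M
        (λ F F∈ _ _ → m≤n+o⇒m∸n≤o q 1 (begin
          q                                                                          ≤⟨ cover-count (span-isSubspace cs) cover F∈ ⟩
          count (span cs ∩ F)                                                        ≡⟨ count-split (span cs ∩ F) (span []) ⟩
          count ((span cs ∩ F) ∩ span []) + count ((span cs ∩ F) ∖ span [])          ≤⟨ +-mono-≤
              (≤-trans (count-mono (λ v h → proj₂ (∧-true {span cs v ∧ F v} h))) (≤-reflexive count-span-[]))
              (count-mono (λ v h → let cF , z = ∧-true {span cs v ∧ F v} h; c , f = ∧-true {span cs v} cF in ∧-intro (∧-intro c z) f)) ⟩
          1 + count ((span cs ∖ span []) ∩ F)                                        ∎))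
        (λ a a∈ → let c , z = ∧-true {span cs a} a∈ in ≤M a c (λ a≡0 → true≢false z (cong not (trans (cong (span []) a≡0) (0∈ (span-isSubspace [])))))))
      (*-monoˡ-≤ M (∸-monoˡ-≤ 1 (begin
        1 + count (span cs ∖ span [])                                                ≤⟨ +-monoˡ-≤ _ (≤-trans (≤-reflexive (sym count-span-[]))
              (count-mono (λ v v∈ → ∧-intro (subst (_∈V span cs) (sym (∈-span-[] {v} v∈)) (0∈ (span-isSubspace cs))) v∈))) ⟩
        count (span cs ∩ span []) + count (span cs ∖ span [])                        ≡⟨ count-split (span cs) (span []) ⟨
        count (span cs)                                                              ≤⟨ count-span-≤ cs ⟩
        q ^ length cs                                                                ∎)))
      where open ≤-Reasoning
    -- Below dimension `τ`, `H` makes the span of `us` a non-cover, so some member `G` misses it,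
    -- and branching over `G` adjoins only vectors outside the span. Each step costs
    -- `(q ^ k ∸ 1) / (q ∸ 1)`; at dimension `τ`, `deg-bound` takes over. `H` is restricted to
    -- tuples inside selected members so that it can hold for a filtered family.
    descent : ∀ w τ l → τ + l ≡ k →
      (∀ us → Indep us → length us < τ → (∃ λ F → F ∈ ℱ × w F ≡ true × all F us ≡ true) → ¬ Cover (span us)) →
      ∀ s us → Indep us → length us + s ≡ τ →
      (q ∸ 1) ^ s * (fall k τ l * deg w us) ≤ (q ^ k ∸ 1) ^ s * fall n τ l
    descent w τ l τ+l≡k H zero us indep refl =
      *-monoʳ-≤ 1 (subst (λ t → fall k t l * deg w us ≤ fall n t l) (sym (+-identityʳ _))
        (deg-bound w l us indep (trans (cong (_+ l) (sym (+-identityʳ _))) τ+l≡k)))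
    descent w τ l τ+l≡k H (suc s) us indep len with 0 <? deg w us
    -- With no selected member through `us` the left side is zero; otherwise such a member is the
    -- witness that `H` asks for.
    ... | no deg≯0 = subst (λ x → (q ∸ 1) ^ suc s * (fall k τ l * x) ≤ _) (sym (n≤0⇒n≡0 (≮⇒≥ deg≯0)))
            (≤-trans (≤-reflexive (trans (cong ((q ∸ 1) ^ suc s *_) (*-zeroʳ (fall k τ l))) (*-zeroʳ ((q ∸ 1) ^ suc s)))) z≤n)
    ... | yes deg>0 with F , F∈ , 0<ind ← ∑-pos ℱ (λ F → ind (w F ∧ all F us)) deg>0 =
      decidable-stable (_ ≤? _) (λ ≰ → H us indep (m+1+n≡o⇒m<o len)
        (F , F∈ , ∧-true (ind-pos 0<ind)) (λ {G} G∈ disj → ≰ (step G∈ disj)))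
      where
      open ≤-Reasoning
      y = q ^ k ∸ 1
      ind-pos : ∀ {b} → 0 < ind b → b ≡ true
      ind-pos {true} _ = refl
      step : ∀ {G} → G ∈ ℱ → Disjoint (span us) G → (q ∸ 1) ^ suc s * (fall k τ l * deg w us) ≤ y ^ suc s * fall n τ l
      step {G} G∈ disj = begin
        (q ∸ 1) ^ suc s * (fall k τ l * deg w us)             ≡⟨ regroup (q ∸ 1) ((q ∸ 1) ^ s) (fall k τ l) (deg w us) ⟩
        (q ∸ 1) * (((q ∸ 1) ^ s * fall k τ l) * deg w us)     ≤⟨ branch w us (basis D) ((q ∸ 1) ^ s * fall k τ l) (y ^ s * fall n τ l) (basis-indep D) (basis-cover G∈) next ⟩
        (q ^ length (basis D) ∸ 1) * (y ^ s * fall n τ l)     ≡⟨ cong (λ t → (q ^ t ∸ 1) * (y ^ s * fall n τ l)) (basis-length D) ⟩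
        y * (y ^ s * fall n τ l)                              ≡⟨ *-assoc y (y ^ s) _ ⟨
        y ^ suc s * fall n τ l                                ∎
        where
        D = dim G∈
        regroup : ∀ a b c e → a * b * (c * e) ≡ a * ((b * c) * e)
        regroup = solve-∀
        next : ∀ a → a ∈V span (basis D) → a ≢ zeroV → ((q ∸ 1) ^ s * fall k τ l) * deg w (a ∷ us) ≤ y ^ s * fall n τ l
        next a a∈ a≢0 = ≤-trans (≤-reflexive (*-assoc ((q ∸ 1) ^ s) _ _))
          (descent w τ l τ+l≡k H s (a ∷ us) (indep , Bool.¬-not (λ a∈us → a≢0 (disj a a∈us (trans (basis-span D a) a∈))))
            (trans (sym (+-suc (length us) s)) len))

    one : Weight
    one _ = true

    -- The tuple grows to length `d` by vectors independent modulo the cover. A member through `us`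
    -- also holds a nonzero vector of the cover, so it loses q^(j+1) of its vectors, rather than
    -- q^j, to the span of `us ++ ts`; this is the shift by `suc` in `fall k`.
    averaging : ∀ d B Y ts → Indep ts → Cover (span ts) → d + length ts ≤ n →
      (∀ us → Indep us → length us ≡ d → B < Y * deg one us) →
      ∀ i us → Indep (us ++ ts) → length us + i ≡ d →
      fall n (length us + length ts) i * B < fall k (suc (length us)) i * (Y * deg one us)
    averaging d B Y ts ts-indep cover d+τ≤n large zero us indep len =
      subst₂ _<_ (sym (+-identityʳ B)) (sym (+-identityʳ _)) (large us (Indep-++ˡ us ts indep) (trans (sym (+-identityʳ _)) len))
    averaging d B Y ts ts-indep cover d+τ≤n large (suc i) us indep len = begin-strict
      c * fall n (suc (j + τ)) i * B                      ≡⟨ *-assoc c _ B ⟩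
      -- The recursive bound is strict, so it also bounds the successor; positivity of `c` carries
      -- the strictness through the product.
      c * (fall n (suc (j + τ)) i * B)                    <⟨ *-monoʳ-< c {{>-nonZero c>0}} ≤-refl ⟩
      c * suc (fall n (suc (j + τ)) i * B)                ≤⟨ *-monoˡ-≤ (suc (fall n (suc (j + τ)) i * B)) c≤ ⟩
      count (∁ (span (us ++ ts))) * suc (fall n (suc (j + τ)) i * B)
                                                          ≤⟨ extend-≥ one us (∁ (span (us ++ ts))) x (fall k (suc (suc j)) i * Y) _ inside next ⟩
      x * (fall k (suc (suc j)) i * Y * deg one us)       ≡⟨ regroup x (fall k (suc (suc j)) i) Y (deg one us) ⟩
      x * fall k (suc (suc j)) i * (Y * deg one us)       ∎
      where
      open ≤-Reasoning
      j = length us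
      τ = length ts
      c = q ^ n ∸ q ^ (j + τ)
      x = q ^ k ∸ q ^ suc j
      regroup : ∀ a b c e → a * (b * c * e) ≡ a * b * (c * e)
      regroup = solve-∀
      c>0 : 0 < c
      c>0 = m<n⇒0<n∸m (^-monoʳ-< q 2≤q (≤-trans (+-monoˡ-≤ τ (m+1+n≡o⇒m<o len)) d+τ≤n))
      c≤ : c ≤ count (∁ (span (us ++ ts)))
      c≤ = m≤n+o⇒m∸n≤o (q ^ n) (q ^ (j + τ)) (begin
        q ^ n                                                               ≡⟨ count-∁ (us ++ ts) ⟨
        count (∁ (span (us ++ ts))) + count (span (us ++ ts))               ≡⟨ +-comm _ (count (span (us ++ ts))) ⟩
        count (span (us ++ ts)) + count (∁ (span (us ++ ts)))               ≤⟨ +-monoˡ-≤ _ (count-span-≤ (us ++ ts)) ⟩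
        q ^ length (us ++ ts) + count (∁ (span (us ++ ts)))                 ≡⟨ cong (λ t → q ^ t + count (∁ (span (us ++ ts)))) (length-++ us) ⟩
        q ^ (j + τ) + count (∁ (span (us ++ ts)))                           ∎)
      inside : ∀ F → F ∈ ℱ → all F us ≡ true → count (∁ (span (us ++ ts)) ∩ F) ≤ x
      inside F F∈ us⊆F = m+n≤o⇒m≤o∸n _ (begin
        count (∁ (span (us ++ ts)) ∩ F) + q ^ suc j                         ≤⟨ +-mono-≤ (count-mono (λ v h → ∧-intro (proj₂ (∧-true {not (span (us ++ ts) v)} h)) (proj₁ (∧-true {not (span (us ++ ts) v)} h)))) meets ⟩
        count (F ∖ span (us ++ ts)) + count (F ∩ span (us ++ ts))           ≡⟨ +-comm (count (F ∖ span (us ++ ts))) _ ⟩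
        count (F ∩ span (us ++ ts)) + count (F ∖ span (us ++ ts))           ≡⟨ count-split F (span (us ++ ts)) ⟨
        count F                                                             ≡⟨ count≡ (dim F∈) ⟩
        q ^ k                                                               ∎)
        where
        -- A nonzero vector of the cover in `F` lies outside `span us`, because the spans of `us`
        -- and `ts` meet trivially; together with `us` it spans q^(j+1) vectors of the intersection.
        meets : q ^ suc j ≤ count (F ∩ span (us ++ ts))
        meets = decidable-stable (q ^ suc j ≤? _) (λ ≰ → cover F∈ (λ v v∈ts v∈F → decidable-stable (VecP.≡-dec Fin._≟_ v zeroV) (λ v≢0 →
          ≰ (≤-trans (count-span-≥ (v ∷ us) (Indep-++ˡ us ts indep , Bool.¬-not (λ v∈us → v≢0 (Indep-++⇒Disjoint us ts indep v v∈us v∈ts))))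
            (count-mono (λ u u∈ → ∧-intro (all⇒span⊆ (isSubspace (dim F∈)) (v ∷ us) (∧-intro v∈F us⊆F) u u∈)
              (all⇒span⊆ (span-isSubspace (us ++ ts)) (v ∷ us) (∧-intro (span-⊆-++ˡ us ts v v∈ts) (span⊆⇒all us (span-⊆-++ʳ us ts))) u u∈)))))))
      next : ∀ a → a ∈V ∁ (span (us ++ ts)) → fall n (suc (j + τ)) i * B < fall k (suc (suc j)) i * Y * deg one (a ∷ us)
      next a a∉ = ≤-trans
        (averaging d B Y ts ts-indep cover d+τ≤n large i (a ∷ us) (indep , Bool.¬-not (λ a∈ → true≢false a∉ (cong not a∈))) (trans (sym (+-suc j i)) len))
        (≤-reflexive (sym (*-assoc (fall k (suc (suc j)) i) Y _)))

    -- Contradiction from all d-degrees being too large.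

    module Refutation (d e : ℕ) (1+d+e≡k : suc (d + e) ≡ k) (2<k : 2 < k) (2k+1≤n : 2 * k + 1 ≤ n)
      (large : ∀ us → Indep us → length us ≡ d → fall n (suc d) e < fall k (suc d) e * deg one us) where

      open ≤-Reasoning

      N y : ℕ
      N = deg one []
      y = q ^ k ∸ 1

      d<k : d < k
      d<k = m+1+n≡o⇒m<o (trans (+-suc d e) 1+d+e≡k)

      average : ∀ ts → Indep ts → length ts ≤ k → Cover (span ts) →
        fall n (length ts) d * fall n (suc d) e < fall k 1 d * (fall k (suc d) e * N)
      average ts indep len≤k cover = averaging d _ (fall k (suc d) e) ts indep cover
        (≤-trans (+-mono-≤ (<⇒≤ d<k) len≤k) (≤-trans (≤-reflexive (cong (k +_) (sym (+-identityʳ k)))) (≤-trans (m≤m+n (2 * k) 1) 2k+1≤n)))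
        large d [] indep refl

      -- The source of a regained factor `q`: branching over a cover of dimension below `k` in place
      -- of a `k`-space.
      q*[q^∸1] : ∀ {a b} → a < b → q * (q ^ a ∸ 1) ≤ q ^ b ∸ 1
      q*[q^∸1] {a} {b} a<b = begin
        q * (q ^ a ∸ 1)       ≡⟨ *-distribˡ-∸ q (q ^ a) 1 ⟩
        q ^ suc a ∸ q * 1     ≤⟨ ∸-mono (^-monoʳ-≤ q a<b) (≤-trans (≤-trans (s≤s z≤n) 2≤q) (≤-reflexive (sym (*-identityʳ q)))) ⟩
        q ^ b ∸ 1             ∎

      drop-power : ∀ s {x z} → (q ∸ 1) ^ s * x ≤ z → x ≤ z
      drop-power s {x} h = ≤-trans (m≤n*m x ((q ∸ 1) ^ s) {{m^n≢0 (q ∸ 1) s}}) h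

      module MinimalCover (ts : List V) (s l : ℕ) (len : length ts ≡ suc s) (d+e≡s+l : d + e ≡ s + l)
        (ts-indep : Indep ts) (cover : Cover (span ts))
        (minimal : ∀ us → Indep us → length us < suc s → ¬ Cover (span us)) where

        τ = suc s

        τ+l≡k : τ + l ≡ k
        τ+l≡k = trans (cong suc (sym d+e≡s+l)) 1+d+e≡k

        a b A B : ℕ
        a = fall k 1 s
        b = fall k τ l
        A = fall n (suc d) s
        B = fall n τ l

        -- The exchange of ranges splits the lower bound into `A`, to be compared with `s`
        -- branchings through `[qy]^s*a≤A`, and `B`, where `B / b` bounds the degree of a `τ`-space.
        -- Every case below refutes this inequality.
        AB<abN : A * B < a * b * N
        AB<abN = begin-strict
          A * B                                              ≡⟨ fall-exchange n {d} {e} {s} {l} d+e≡s+l ⟨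
          fall n (suc d) e * fall n τ d                      ≡⟨ *-comm (fall n (suc d) e) _ ⟩
          fall n τ d * fall n (suc d) e                      <⟨ subst (λ t → fall n t d * fall n (suc d) e < fall k 1 d * (fall k (suc d) e * N)) len
                                                                  (average ts ts-indep (≤-trans (≤-reflexive len) (≤-trans (m≤m+n τ l) (≤-reflexive τ+l≡k))) cover) ⟩
          fall k 1 d * (fall k (suc d) e * N)                ≡⟨ *-assoc (fall k 1 d) _ N ⟨
          fall k 1 d * fall k (suc d) e * N                  ≡⟨ cong (_* N) (fall-+ k 1 d e) ⟨
          fall k 1 (d + e) * N                               ≡⟨ cong (λ t → fall k 1 t * N) d+e≡s+l ⟩
          fall k 1 (s + l) * N                               ≡⟨ cong (_* N) (fall-+ k 1 s l) ⟩
          a * b * N                                          ∎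

        [qy]^s*a≤A : (q * y) ^ s * a ≤ A
        [qy]^s*a≤A = ≤-trans (fall-bound 1 s d<k 2k+1≤n (≤-trans (m≤m+n (suc s) l) (≤-trans (≤-reflexive τ+l≡k) (n≤1+n k))))
          (≤-reflexive (cong (λ t → fall n t s) (+-comm d 1)))

        -- For `τ = 1` all members contain the single point of the cover, so `deg-bound` applies at
        -- once; `a` and `A` are empty products.
        case-point : s ≡ 0 → ⊥
        case-point refl = <⇒≱ AB<abN (begin
          a * b * N      ≡⟨ cong (_* N) (*-identityˡ b) ⟩
          b * N          ≤⟨ *-cancelˡ-≤ (q ∸ 1) (≤-trans (branch one [] ts b B ts-indep cover
                              (λ p p∈ p≢0 → deg-bound one l (p ∷ []) Indep-[ p≢0 ] τ+l≡k))
                              (≤-reflexive (cong (λ t → (t ∸ 1) * B) (trans (cong (q ^_) len) (*-identityʳ q))))) ⟩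
          B              ≡⟨ *-identityˡ B ⟨
          A * B          ∎)

        -- The hypothesis is what `k` branchings down to a single member give. After
        -- `fall-bound-full`, lowering the last `l` indices by `d` only enlarges their factors and
        -- produces `B`.
        full-bound : ∀ x → (q ∸ 1) ^ k * x ≤ y ^ k → fall k 1 (s + l) * x ≤ A * B
        full-bound x h = begin
          fall k 1 (s + l) * x         ≤⟨ *-cancelˡ-≤ ((q ∸ 1) ^ k) {{m^n≢0 (q ∸ 1) k}} (begin
            (q ∸ 1) ^ k * (fall k 1 (s + l) * x)    ≡⟨ swap ((q ∸ 1) ^ k) (fall k 1 (s + l)) x ⟩
            (q ∸ 1) ^ k * x * fall k 1 (s + l)      ≤⟨ *-monoˡ-≤ _ h ⟩
            y ^ k * fall k 1 (s + l)                ≤⟨ subst (λ t → y ^ k * fall k 1 t ≤ (q ∸ 1) ^ k * fall n (suc d) t) (cong (_∸ 1) (sym τ+l≡k)) (fall-bound-full 2<k d<k 2k+1≤n) ⟩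
            (q ∸ 1) ^ k * fall n (suc d) (s + l)    ∎) ⟩
          fall n (suc d) (s + l)       ≡⟨ fall-+ n (suc d) s l ⟩
          A * fall n (suc d + s) l     ≤⟨ *-monoʳ-≤ A (fall-anti n l (s≤s (m≤n+m s d))) ⟩
          A * B                        ∎
          where
          swap : ∀ u v w → u * (v * w) ≡ u * w * v
          swap = solve-∀

        -- For `τ = k` no space of smaller dimension is a cover, so the descent runs from the empty
        -- tuple through all `k` steps.
        case-top : l ≡ 0 → ⊥
        case-top refl = <⇒≱ AB<abN (≤-trans (≤-reflexive (cong (_* N) (sym (fall-+ k 1 s 0)))) (full-bound N (begin
          (q ∸ 1) ^ k * N                  ≡⟨ cong ((q ∸ 1) ^ k *_) (*-identityˡ N) ⟨
          (q ∸ 1) ^ k * (1 * N)            ≤⟨ descent one k 0 (+-identityʳ k) (λ us i lt _ → minimal us i (≤-trans lt (≤-reflexive (trans (sym τ+l≡k) (+-identityʳ τ))))) k [] tt refl ⟩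
          y ^ k * 1                        ≡⟨ *-identityʳ (y ^ k) ⟩
          y ^ k                            ∎)))

        -- p lies in every cover of dimension below k, so no proper subspace of a member avoiding p
        -- is a cover, and the members avoiding p can be reached by descending all the way to dimension k.
        case-common : 0 < s → 0 < l → ∀ p → p ∈V span ts → p ≢ zeroV →
          (∀ cs → Indep cs → length cs < k → Cover (span cs) → p ∈V span cs) → ⊥
        case-common 0<s 0<l p p∈ p≢0 common = <⇒≱ AB<abN (*-cancelˡ-≤ q (begin
          q * (a * b * N)                         ≡⟨ cong (λ z → q * (a * b * z)) N-split ⟩
          q * (a * b * (g + h))                   ≡⟨ expand q (a * b) g h ⟩
          a * b * (q * g) + q * (a * b * h)       ≤⟨ +-mono-≤ (≤-trans (≤-reflexive (cong (_* (q * g)) (sym (fall-+ k 1 s l)))) (full-bound (q * g) g-bound)) h-bound ⟩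
          A * B + A * B                           ≡⟨ cong (A * B +_) (+-identityʳ (A * B)) ⟨
          2 * (A * B)                             ≤⟨ *-monoˡ-≤ (A * B) 2≤q ⟩
          q * (A * B)                             ∎))
          where
          avoid : Weight
          avoid F = not (F p)
          g h : ℕ
          g = deg avoid []
          h = deg one (p ∷ [])
          N-split : N ≡ g + h
          N-split = trans (∑-cong ℱ (λ F → split (F p))) (∑-+ ℱ _ _)
            where
            split : ∀ x → 1 ≡ ind (not x ∧ true) + ind (x ∧ true)
            split true  = refl
            split false = refl
          expand : ∀ q c g h → q * (c * (g + h)) ≡ c * (q * g) + q * (c * h)
          expand = solve-∀
          h-bound : q * (a * b * h) ≤ A * B
          h-bound = begin
            -- The extra `q` is taken from the `q ^ s` that `[qy]^s*a≤A` leaves over, `s` being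
            -- positive.
            q * (a * b * h)              ≤⟨ *-monoˡ-≤ (a * b * h) (≤-trans (≤-reflexive (sym (*-identityʳ q))) (^-monoʳ-≤ q 0<s)) ⟩
            q ^ s * (a * b * h)          ≡⟨ cong (q ^ s *_) (*-assoc a b h) ⟩
            q ^ s * (a * (b * h))        ≤⟨ *-monoʳ-≤ (q ^ s) (*-monoʳ-≤ a (drop-power s
                                              (descent one τ l τ+l≡k (λ us i lt _ → minimal us i lt) s (p ∷ []) Indep-[ p≢0 ] refl))) ⟩
            q ^ s * (a * (y ^ s * B))    ≡⟨ regroup (q ^ s) a (y ^ s) B ⟩
            q ^ s * y ^ s * a * B        ≡⟨ cong (λ z → z * a * B) (^-distrib-* q y s) ⟨
            (q * y) ^ s * a * B          ≤⟨ *-monoˡ-≤ B [qy]^s*a≤A ⟩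
            A * B                        ∎
            where
            regroup : ∀ u a v b → u * (a * (v * b)) ≡ u * v * a * b
            regroup = solve-∀
          no-cover : ∀ us → Indep us → length us < k → (∃ λ F → F ∈ ℱ × avoid F ≡ true × all F us ≡ true) → ¬ Cover (span us)
          no-cover us indep len<k (F , F∈ , p∉F , us⊆F) c =
            true≢false p∉F (cong not (all⇒span⊆ (isSubspace (dim F∈)) us us⊆F p (common us indep len<k c)))
          k∸1 = s + l
          g-branch : (q ∸ 1) * ((q ∸ 1) ^ k∸1 * g) ≤ (q ^ τ ∸ 1) * y ^ k∸1
          g-branch = subst (λ t → (q ∸ 1) * ((q ∸ 1) ^ k∸1 * g) ≤ (q ^ t ∸ 1) * y ^ k∸1) len
            (branch avoid [] ts ((q ∸ 1) ^ k∸1) (y ^ k∸1) ts-indep cover (λ v v∈ v≢0 → begin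
              (q ∸ 1) ^ k∸1 * deg avoid (v ∷ [])           ≡⟨ cong ((q ∸ 1) ^ k∸1 *_) (*-identityˡ (deg avoid (v ∷ []))) ⟨
              (q ∸ 1) ^ k∸1 * (1 * deg avoid (v ∷ []))     ≤⟨ descent avoid k 0 (+-identityʳ k) no-cover k∸1 (v ∷ []) Indep-[ v≢0 ] τ+l≡k ⟩
              y ^ k∸1 * 1                                  ≡⟨ *-identityʳ (y ^ k∸1) ⟩
              y ^ k∸1                                      ∎))
          g-bound : (q ∸ 1) ^ k * (q * g) ≤ y ^ k
          g-bound = subst (λ t → (q ∸ 1) ^ t * (q * g) ≤ y ^ t) τ+l≡k (begin
            (q ∸ 1) * (q ∸ 1) ^ k∸1 * (q * g)      ≡⟨ regroup (q ∸ 1) ((q ∸ 1) ^ k∸1) q g ⟩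
            q * ((q ∸ 1) * ((q ∸ 1) ^ k∸1 * g))    ≤⟨ *-monoʳ-≤ q g-branch ⟩
            q * ((q ^ τ ∸ 1) * y ^ k∸1)            ≡⟨ *-assoc q (q ^ τ ∸ 1) _ ⟨
            -- The first branching is over the cover itself, whose dimension `τ` is below `k`; this
            -- makes room for the extra `q`.
            q * (q ^ τ ∸ 1) * y ^ k∸1              ≤⟨ *-monoˡ-≤ (y ^ k∸1) (q*[q^∸1] (≤-trans (m<m+n τ 0<l) (≤-reflexive τ+l≡k))) ⟩
            y * y ^ k∸1                            ∎)
            where
            regroup : ∀ u v q g → u * v * (q * g) ≡ q * (u * (v * g))
            regroup = solve-∀

        -- The first branching costs at most q^τ, one `q` more than `q ^ s`. The second is over a
        -- cover of dimension at most `k − 1` missing `p`, and its cost times that `q` is still at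
        -- most `y`. With the remaining `s′` steps of descent the total is `(q * y) ^ s`.
        case-avoid : ∀ s′ → s ≡ suc s′ →
          (∀ p → p ∈V span ts → p ≢ zeroV → ¬ (∀ cs → Indep cs → length cs < k → Cover (span cs) → p ∈V span cs)) → ⊥
        case-avoid s′ refl uncommon = <⇒≱ AB<abN (begin
          a * b * N                                                 ≡⟨ *-assoc a b N ⟩
          a * (b * N)                                               ≤⟨ *-monoʳ-≤ a (drop-power 1 (≤-trans (≤-reflexive (cong (_* (b * N)) (*-identityʳ (q ∸ 1))))
                                                                         (branch one [] ts b M ts-indep cover point-bound))) ⟩
          a * ((q ^ length ts ∸ 1) * M)                             ≤⟨ *-monoʳ-≤ a (*-monoˡ-≤ M (≤-trans (m∸n≤m _ 1) (≤-reflexive (cong (q ^_) len)))) ⟩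
          a * (q ^ τ * M)                                           ≡⟨ regroup₁ a q (q ^ s) (q ^ (s + l) ∸ 1) (y ^ s′) B ⟩
          q * (q ^ (s + l) ∸ 1) * (q ^ s * (y ^ s′ * (a * B)))      ≤⟨ *-monoˡ-≤ (q ^ s * (y ^ s′ * (a * B))) (q*[q^∸1] (≤-reflexive τ+l≡k)) ⟩
          y * (q ^ s * (y ^ s′ * (a * B)))                          ≡⟨ regroup₂ y (q ^ s) (y ^ s′) a B ⟩
          q ^ s * y ^ s * a * B                                     ≡⟨ cong (λ z → z * a * B) (^-distrib-* q y s) ⟨
          (q * y) ^ s * a * B                                       ≤⟨ *-monoˡ-≤ B [qy]^s*a≤A ⟩
          A * B                                                     ∎)
          where
          M : ℕ
          M = (q ^ (s + l) ∸ 1) * (y ^ s′ * B)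
          regroup₁ : ∀ a q u v w b → a * (q * u * (v * (w * b))) ≡ q * v * (u * (w * (a * b)))
          regroup₁ = solve-∀
          regroup₂ : ∀ y u w a b → y * (u * (w * (a * b))) ≡ u * (y * w) * a * b
          regroup₂ = solve-∀
          point-bound : ∀ p → p ∈V span ts → p ≢ zeroV → b * deg one (p ∷ []) ≤ M
          point-bound p p∈ p≢0 = decidable-stable (_ ≤? _) (λ ≰ → uncommon p p∈ p≢0 (λ cs cs-indep cs<k cs-cover →
            decidable-stable (span cs p Bool.≟ true) (λ p∉ → ≰ (avoiding cs cs-indep cs<k cs-cover (Bool.¬-not p∉)))))
            where
            avoiding : ∀ cs → Indep cs → length cs < k → Cover (span cs) → span cs p ≡ false → b * deg one (p ∷ []) ≤ M
            avoiding cs cs-indep cs<k cs-cover p∉ = begin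
              b * deg one (p ∷ [])                         ≤⟨ drop-power 1 (≤-trans (≤-reflexive (cong (_* (b * deg one (p ∷ []))) (*-identityʳ (q ∸ 1))))
                                                                (branch one (p ∷ []) cs b (y ^ s′ * B) cs-indep cs-cover line-bound)) ⟩
              (q ^ length cs ∸ 1) * (y ^ s′ * B)           ≤⟨ *-monoˡ-≤ (y ^ s′ * B) (∸-monoˡ-≤ 1 (^-monoʳ-≤ q (s≤s⁻¹ (≤-trans cs<k (≤-reflexive (sym τ+l≡k)))))) ⟩
              M                                            ∎
              where
              line-bound : ∀ v → v ∈V span cs → v ≢ zeroV → b * deg one (v ∷ p ∷ []) ≤ y ^ s′ * B
              line-bound v v∈ v≢0 = drop-power s′ (descent one τ l τ+l≡k (λ us i lt _ → minimal us i lt) s′ (v ∷ p ∷ [])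
                (Indep-[ p≢0 ] , Bool.¬-not v∉) refl)
                where
                v+0p≡v : v +V (0# ·V p) ≡ v
                v+0p≡v = trans (cong (v +V_) (·V-zeroˡ p)) (+V-identityʳ v)
                v∉ : ¬ (v ∈V span (p ∷ []))
                -- Membership means v + c p = 0. As `v` is in `span cs` and `p` is not, `c` is zero,
                -- and then so is `v`.
                v∉ v∈p with c , v+cp∈ ← ∈-span-∷⁻ {v} p [] v∈p = v≢0 (trans (sym v+0p≡v)
                  (trans (cong (λ z → v +V (z ·V p)) (sym c≡0)) (∈-span-[] {v +V (c ·V p)} v+cp∈)))
                  where
                  c≡0 : c ≡ 0#
                  c≡0 = translate-injective (span-isSubspace cs) {v} {p} c 0#
                    (subst (_∈V span cs) (sym (∈-span-[] {v +V (c ·V p)} v+cp∈)) (0∈ (span-isSubspace cs)))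
                    (subst (_∈V span cs) (sym v+0p≡v) v∈) p∉

        impossible : ⊥
        impossible = cases s refl
          where
          cases : ∀ s₀ → s ≡ s₀ → ⊥
          cases zero     s≡0 = case-point s≡0
          cases (suc s′) s≡  with l ≟ 0
          ... | yes l≡0 = case-top l≡0
          ... | no  l≢0 = case-avoid s′ s≡ (case-common (≤-trans (s≤s z≤n) (≤-reflexive (sym s≡))) (n≢0⇒n>0 l≢0))

      -- The strict inequality of `average` for the empty tuple cannot have zero on its right side.
      N>0 : Cover (span []) → 0 < N
      N>0 cover = n≢0⇒n>0 (λ N≡0 → n≮0 (≤-trans (average [] tt z≤n cover) (≤-reflexive (begin-equality
        fall k 1 d * (fall k (suc d) e * N)   ≡⟨ cong (λ z → fall k 1 d * (fall k (suc d) e * z)) N≡0 ⟩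
        fall k 1 d * (fall k (suc d) e * 0)   ≡⟨ cong (fall k 1 d *_) (*-zeroʳ (fall k (suc d) e)) ⟩
        fall k 1 d * 0                        ≡⟨ *-zeroʳ (fall k 1 d) ⟩
        0                                     ∎))))

      -- Induction on the dimension, with `m` as a bound, stands in for choosing a least cover: once
      -- smaller covers are excluded, any cover is minimal.
      no-cover : ∀ m us → length us < m → length us ≤ k → Indep us → ¬ Cover (span us)
      no-cover (suc m) [] _ _ _ cover
        -- A positive `N` yields a member, and the zero space meets it trivially.
        with F , F∈ , _ ← ∑-pos ℱ (λ F → ind (one F ∧ all F [])) (N>0 cover) = cover F∈ (λ v v∈ _ → ∈-span-[] {v} v∈)
      no-cover (suc m) us@(u ∷ us′) (s≤s len≤m) len≤k indep cover with l , τ+l≡k ← m≤n⇒∃[o]m+o≡n len≤k =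
        MinimalCover.impossible us (length us′) l refl (suc-injective (trans 1+d+e≡k (sym τ+l≡k))) indep cover
          (λ vs vs-indep vs<τ → no-cover m vs (≤-trans vs<τ len≤m) (≤-trans (<⇒≤ vs<τ) len≤k) vs-indep)

      contradictory : ⊥
      -- The basis of a member would span a cover of dimension `k`, already excluded. So there are
      -- no members, the zero space is vacuously a cover, and the base case refutes that.
      contradictory = no-cover 1 [] (s≤s z≤n) z≤n tt (λ F∈ _ → no-cover (suc k) (basis (dim F∈))
        (s≤s (≤-reflexive (basis-length (dim F∈)))) (≤-reflexive (basis-length (dim F∈))) (basis-indep (dim F∈)) (basis-cover F∈))

  -- Finite search for a d-space of small degree.

  tuples : ℕ → List (List V)
  tuples zero    = [] ∷ []
  tuples (suc d) = cartesianProductWith _∷_ (allV n) (tuples d)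

  ∈-tuples : ∀ us → us ∈ tuples (length us)
  ∈-tuples []       = here refl
  ∈-tuples (u ∷ us) = ∈-cartesianProductWith⁺ _∷_ (∈-allV u) (∈-tuples us)

  degree≤∑ : ∀ us ℱ → degree (span us) ℱ ≤ ∑ ℱ (λ F → ind (all F us))
  degree≤∑ us []      = z≤n
  degree≤∑ us (F ∷ ℱ) with span us ⊆? F
  ... | yes us⊆F = +-mono-≤ (≤-reflexive (sym (cong ind (span⊆⇒all us us⊆F)))) (degree≤∑ us ℱ)
  ... | no  _    = ≤-trans (degree≤∑ us ℱ) (m≤n+m _ _)

theorem1p4 : (q : ℕ) (𝔽 : FiniteField q) (n k d : ℕ) →
    2 ≤ d → d < k → 2 * k + 1 ≤ n →
    let open Space 𝔽 n in
    (ℱ : List Subset) →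
    All (IsSubspaceOfDim k) ℱ →
    AllPairs (λ F G → ¬ SameSet F G) ℱ →
    (∀ F G → F ∈ ℱ → G ∈ ℱ → DimAtLeast 1 (F ∩ G)) →
    ∃ λ S → IsSubspaceOfDim d S × degree S ℱ ≤ gaussBinom q (n ∸ d ∸ 1) (k ∸ d ∸ 1)
theorem1p4 q 𝔽 n k d 2≤d d<k 2k+1≤n ℱ dims distinct meets =
  -- The witness is sought among all `d`-tuples; failure of this decidable search gives `large` for
  -- every independent one.
  search (Any.any? (λ us → (length us ≟ d) ×-dec (Indep? us ×-dec (deg one us ≤? D))) (tuples d))
  where
  open Counting 𝔽 n
  open Space 𝔽 n
  D = gaussBinom q (n ∸ d ∸ 1) (k ∸ d ∸ 1)
  open Family ℱ k (λ F∈ → hasDim (All.lookup dims F∈)) distinct (λ {F} {G} F∈ G∈ → dim≥1⇒¬Disjoint (meets F G F∈ G∈))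

  search : Dec (Any (λ us → length us ≡ d × Indep us × deg one us ≤ D) (tuples d)) →
    ∃ λ S → IsSubspaceOfDim d S × degree S ℱ ≤ D
  search (yes found) with us , refl , indep , deg≤D ← Any.satisfied found =
    span us , span-isSubspaceOfDim us indep , ≤-trans (degree≤∑ us ℱ) deg≤D
  search (no none) with e , 1+d+e≡k ← m≤n⇒∃[o]m+o≡n d<k =
    -- From `2 ≤ d` and `d < k` comes `2 < k`, which lets `fall-bound-full` split off its last two
    -- factors from `k − 3` others.
    ⊥-elim (Refutation.contradictory d e 1+d+e≡k (≤-trans (s≤s 2≤d) d<k) 2k+1≤n large)
    where
    large : ∀ us → Indep us → length us ≡ d → fall n (suc d) e < fall k (suc d) e * deg one us
    large us indep refl = subst (fall n (suc d) e <_) (*-comm (deg one us) _)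
      (subst (λ t → fall n (suc d) e < deg one us * fall t (suc d) e) 1+d+e≡k
        (gauss<⇒fall< d e (deg one us) (≤-trans (≤-reflexive 1+d+e≡k) k≤n)
          (subst (λ t → gaussBinom q (n ∸ d ∸ 1) t < deg one us) (e≡ 1+d+e≡k)
            (≰⇒> (λ deg≤D → none (lose (∈-tuples us) (refl , indep , deg≤D)))))))
      where
      k≤n : k ≤ n
      k≤n = ≤-trans (m≤m+n k _) (≤-trans (m≤m+n (2 * k) 1) 2k+1≤n)
      e≡ : ∀ {k} → suc (d + e) ≡ k → k ∸ d ∸ 1 ≡ e
      e≡ refl = trans (∸-+-assoc (suc (d + e)) d 1) (trans (cong (suc (d + e) ∸_) (+-comm d 1)) (m+n∸m≡n d e))
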